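{- Let $k$ be a positive integer and, for each $n\ge1$, let $\overline{w}_{n,k}$ denote the number of words $w_1\cdots w_n$ with all $w_i\in[n]$ that contain no weakly increasing subsequence of length $k+1$ (i.e. there are no indices $i_1<\dots<i_{k+1}$ with $w_{i_1}\le w_{i_2}\le\dots\le w_{i_{k+1}}$); equivalently, whose standardization avoids the permutation $12\cdots(k+1)$. Then the limit $\lim_{n\to\infty}\overline{w}_{n,k}^{1/n}$ exists and \[\limsup_{n\to\infty}\overline{w}_{n,k}^{1/n}=\frac{k^{k+1}}{(k-1)^{k-1}},\] with the convention $0^0=1$.
   Context: $[n]=\{1,\dots,n\}$. The standardization $\mathrm{std}(w)$ of a word $w=w_1\cdots w_n$ of positive integers is the permutation of $[n]$ obtained by replacing the letters of $w$ by $1,\dots,n$ preserving relative order, where equal letters are numbered increasingly from left to right. A permutation $\pi$ avoids $\sigma\in\mathfrak S_m$ if no subsequence of $\pi$ of length $m$ is order-isomorphic to $\sigma$. -}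

module Defs where

import Algebra.Definitions.RawSemiring
open import Data.Empty using (⊥)
open import Data.Fin using (Fin; fromℕ<; finToFun; funToFin)
import Data.Fin as Fin
import Data.Fin.Properties as Fin
open import Data.Integer using (+_)
open import Data.List using (List; length; map; filter; allFin)
open import Data.List.Properties using (filter-notAll; length-tabulate)
open import Data.List.Membership.Propositional using (lose)
open import Data.List.Membership.Propositional.Properties using (∈-allFin)
open import Data.Nat using (ℕ; zero; suc; NonZero)
import Data.Nat as ℕ
import Data.Nat.Properties as ℕ
open import Data.Product using (∃; ∃-syntax; _×_; _,_; proj₁; proj₂)
open import Data.Rational hiding (NonZero)
import Data.Rational.Base as ℚ
open import Data.Rational.Properties
open import Data.Sum using (_⊎_; inj₁; inj₂; [_,_]′)
open import Function using (_∘_; id; _⇔_)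
open import Relation.Binary using (tri<; tri≈; tri>)
open import Relation.Binary.PropositionalEquality
open import Relation.Nullary using (¬_; Dec; yes; no; contradiction)
open import Relation.Nullary.Decidable using (map′; ¬?; _×-dec_; _⊎-dec_; _→-dec_)

open Algebra.Definitions.RawSemiring ℚ.+-*-rawSemiring public using (_^_)

-- Words.  The letters 1, …, m are represented by Fin m; only their order matters.

Word : ℕ → ℕ → Set
Word m n = Fin n → Fin m

StrictlyIncreasing : ∀ {m n} → (Fin m → Fin n) → Set
StrictlyIncreasing f = ∀ a b → a Fin.< b → f a Fin.< f b

WeaklyIncreasing : ∀ {m n} → (Fin m → Fin n) → Set
WeaklyIncreasing f = ∀ a b → a Fin.≤ b → f a Fin.≤ f b

HasWeaklyIncreasingSubsequence : ∀ {m n} → ℕ → Word m n → Set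
HasWeaklyIncreasingSubsequence {n = n} l w =
  ∃[ i ] (StrictlyIncreasing {l} {n} i × WeaklyIncreasing (w ∘ i))

hasWeaklyIncreasingSubsequence? : ∀ {m n} l (w : Word m n) →
  Dec (HasWeaklyIncreasingSubsequence l w)
hasWeaklyIncreasingSubsequence? {n = n} l w =
  map′ (λ (c , p) → finToFun c , p)
       (λ (i , s , t) → funToFin i
          , (λ a b a<b → subst₂ Fin._<_ (sym (Fin.finToFun-funToFin i a))
                                        (sym (Fin.finToFun-funToFin i b)) (s a b a<b))
          , (λ a b a≤b → subst₂ (λ x y → w x Fin.≤ w y) (sym (Fin.finToFun-funToFin i a))
                                        (sym (Fin.finToFun-funToFin i b)) (t a b a≤b)))
       (Fin.any? (λ c → si? (finToFun c) ×-dec wi? (w ∘ finToFun c)))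
  where
  si? : ∀ {m n} (f : Fin m → Fin n) → Dec (StrictlyIncreasing f)
  si? f = Fin.all? λ a → Fin.all? λ b → (a Fin.<? b) →-dec (f a Fin.<? f b)
  wi? : ∀ {m n} (f : Fin m → Fin n) → Dec (WeaklyIncreasing f)
  wi? f = Fin.all? λ a → Fin.all? λ b → (a Fin.≤? b) →-dec (f a Fin.≤? f b)

-- Every word occurs exactly once (up to pointwise equality), because finToFun is
-- a bijection between Fin (m ^ n) and the functions Fin n → Fin m.
allWords : ∀ m n → List (Word m n)
allWords m n = map finToFun (allFin (m ℕ.^ n))

w̄ : ℕ → ℕ → ℕ
w̄ n k = length (filter (λ w → ¬? (hasWeaklyIncreasingSubsequence? (suc k) w)) (allWords n n))

Precedes : ∀ {m n} → Word m n → Fin n → Fin n → Set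
Precedes w j i = (w j Fin.< w i) ⊎ (w j ≡ w i × j Fin.< i)

precedes? : ∀ {m n} (w : Word m n) j i → Dec (Precedes w j i)
precedes? w j i = (w j Fin.<? w i) ⊎-dec ((w j Fin.≟ w i) ×-dec (j Fin.<? i))

rank : ∀ {m n} → Word m n → Fin n → ℕ
rank {n = n} w i = length (filter (λ j → precedes? w j i) (allFin n))

rank<n : ∀ {m n} (w : Word m n) i → rank w i ℕ.< n
rank<n {n = n} w i =
  subst (rank w i ℕ.<_) (length-tabulate {n = n} id)
    (filter-notAll (λ j → precedes? w j i) (allFin n) (lose (∈-allFin i) irrefl))
  where
  irrefl : ¬ Precedes w i i
  irrefl (inj₁ p)       = ℕ.<-irrefl refl p
  irrefl (inj₂ (_ , p)) = ℕ.<-irrefl refl p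

-- With letters and values counted from 0, the value at position i is the number of
-- positions numbered before it.
std : ∀ {m n} → Word m n → Fin n → Fin n
std w i = fromℕ< (rank<n w i)

Contains : ∀ {l n} → (Fin n → Fin n) → (Fin l → Fin l) → Set
Contains {l} {n} π σ =
  ∃[ i ] (StrictlyIncreasing {l} {n} i × (∀ a b → σ a Fin.< σ b ⇔ π (i a) Fin.< π (i b)))

Avoids : ∀ {l n} → (Fin n → Fin n) → (Fin l → Fin l) → Set
Avoids π σ = ¬ Contains π σ

identity : ∀ l → Fin l → Fin l
identity l = id

-- Dedekind reals: two-sided, rounded, located cuts of ℚ.

record ℝ : Set₁ where
  field
    L U       : ℚ → Set
    L-inhab   : ∃[ q ] L q
    U-inhab   : ∃[ q ] U q
    L-lower   : ∀ {q r} → q < r → L r → L q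
    L-open    : ∀ {q} → L q → ∃[ r ] (q < r × L r)
    U-upper   : ∀ {q r} → q < r → U q → U r
    U-open    : ∀ {r} → U r → ∃[ q ] (q < r × U q)
    disjoint  : ∀ {q} → L q → U q → ⊥
    located   : ∀ {q r} → q < r → L q ⊎ U r

open ℝ public

infix 4 _<ℝ_
_<ℝ_ : ℝ → ℝ → Set
x <ℝ y = ∃[ q ] (U x q × L y q)

q<q+1 : ∀ q → q < q + 1ℚ
q<q+1 q = subst (_< q + 1ℚ) (+-identityʳ q) (+-monoʳ-< q (positive⁻¹ 1ℚ))

q-1<q : ∀ q → q - 1ℚ < q
q-1<q q = subst (q - 1ℚ <_) (+-identityʳ q) (+-monoʳ-< q (negative⁻¹ (- 1ℚ)))

cancel⁻ : ∀ q e → (q + e) - e ≡ q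
cancel⁻ q e = trans (+-assoc q e (- e)) (trans (cong (_+_ q) (+-inverseʳ e)) (+-identityʳ q))

cancel⁺ : ∀ q e → (q - e) + e ≡ q
cancel⁺ q e = trans (+-assoc q (- e) e) (trans (cong (_+_ q) (+-inverseˡ e)) (+-identityʳ q))

fromℚ : ℚ → ℝ
fromℚ p = record
  { L        = _< p
  ; U        = p <_
  ; L-inhab  = p - 1ℚ , q-1<q p
  ; U-inhab  = p + 1ℚ , q<q+1 p
  ; L-lower  = <-trans
  ; L-open   = <-dense
  ; U-upper  = λ q<r p<q → <-trans p<q q<r
  ; U-open   = λ p<r → let q , p<q , q<r = <-dense p<r in q , q<r , p<q
  ; disjoint = <-asym
  ; located  = loc
  }
  where
  loc : ∀ {q r} → q < r → q < p ⊎ p < r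
  loc {q} {r} q<r with q <? p
  ... | yes q<p = inj₁ q<p
  ... | no  q≮p = inj₂ (≤-<-trans (≮⇒≥ q≮p) q<r)

infixl 6 _+ℚ_
_+ℚ_ : ℝ → ℚ → ℝ
x +ℚ e = record
  { L        = λ q → L x (q - e)
  ; U        = λ q → U x (q - e)
  ; L-inhab  = let q , l = L-inhab x in q + e , subst (L x) (sym (cancel⁻ q e)) l
  ; U-inhab  = let q , u = U-inhab x in q + e , subst (U x) (sym (cancel⁻ q e)) u
  ; L-lower  = λ q<r → L-lower x (shift q<r)
  ; L-open   = λ {q} l → let r , q<r , l′ = L-open x l in
                 r + e , subst (_< r + e) (cancel⁺ q e) (+-monoˡ-< e q<r)
                       , subst (L x) (sym (cancel⁻ r e)) l′
  ; U-upper  = λ q<r → U-upper x (shift q<r)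
  ; U-open   = λ {r} u → let q , q<r , u′ = U-open x u in
                 q + e , subst (q + e <_) (cancel⁺ r e) (+-monoˡ-< e q<r)
                       , subst (U x) (sym (cancel⁻ q e)) u′
  ; disjoint = disjoint x
  ; located  = λ q<r → located x (shift q<r)
  }
  where
  shift : ∀ {q r} → q < r → q - e < r - e
  shift = +-monoˡ-< (- e)

^-nonNeg : ∀ {q} n → 0ℚ ≤ q → 0ℚ ≤ q ^ n
^-nonNeg     zero    0≤q = nonNegative⁻¹ 1ℚ
^-nonNeg {q} (suc n) 0≤q =
  nonNegative⁻¹ _ {{nonNeg*nonNeg⇒nonNeg q {{nonNegative 0≤q}} (q ^ n) {{nonNegative (^-nonNeg n 0≤q)}}}}

^-pos : ∀ {q} n → 0ℚ < q → 0ℚ < q ^ n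
^-pos     zero    0<q = positive⁻¹ 1ℚ
^-pos {q} (suc n) 0<q =
  positive⁻¹ _ {{pos*pos⇒pos q {{positive 0<q}} (q ^ n) {{positive (^-pos n 0<q)}}}}

*-mono-≤-nonNeg : ∀ {a b c d} → 0ℚ ≤ b → 0ℚ ≤ c → a ≤ b → c ≤ d → a * c ≤ b * d
*-mono-≤-nonNeg {a} {b} {c} {d} 0≤b 0≤c a≤b c≤d =
  ≤-trans (*-monoʳ-≤-nonNeg c {{nonNegative 0≤c}} a≤b) (*-monoˡ-≤-nonNeg b {{nonNegative 0≤b}} c≤d)

^-mono-≤ : ∀ {q r} n → 0ℚ ≤ q → q ≤ r → q ^ n ≤ r ^ n
^-mono-≤ zero    0≤q q≤r = ≤-refl
^-mono-≤ (suc n) 0≤q q≤r =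
  *-mono-≤-nonNeg (≤-trans 0≤q q≤r) (^-nonNeg n 0≤q) q≤r (^-mono-≤ n 0≤q q≤r)

^-mono-< : ∀ {q r} n .{{_ : NonZero n}} → 0ℚ ≤ q → q < r → q ^ n < r ^ n
^-mono-< {q} {r} (suc n) 0≤q q<r = ≤-<-trans
  (*-monoˡ-≤-nonNeg q {{nonNegative 0≤q}} (^-mono-≤ n 0≤q (<⇒≤ q<r)))
  (*-monoˡ-<-pos (r ^ n) {{positive (^-pos n (≤-<-trans 0≤q q<r))}} q<r)

x*c/x : ∀ x c .{{_ : ℚ.NonZero x}} → x * (1/ x * c) ≡ c
x*c/x x c = trans (sym (*-assoc x (1/ x) c)) (trans (cong (_* c) (*-inverseʳ x)) (*-identityˡ c))

enlarge : ∀ {x y c} → 0ℚ ≤ x → x * y < c → ∃[ z ] (y < z × x * z < c)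
enlarge {x} {y} {c} 0≤x xy<c with <-cmp 0ℚ x
... | tri< 0<x _ _ =
  let instance
        x⁺ : Positive x
        x⁺ = positive 0<x
        x≢0 : ℚ.NonZero x
        x≢0 = pos⇒nonZero x
      z , y<z , z<c/x = <-dense (*-cancelˡ-<-nonNeg x {{pos⇒nonNeg x}} {y} {1/ x * c}
                                   (subst (x * y <_) (sym (x*c/x x c)) xy<c))
  in z , y<z , subst (x * z <_) (x*c/x x c) (*-monoʳ-<-pos x z<c/x)
... | tri≈ _ refl _ =
  y + 1ℚ , q<q+1 y , subst (_< c) (trans (*-zeroˡ y) (sym (*-zeroˡ (y + 1ℚ)))) xy<c
... | tri> _ _ x<0 = contradiction (≤-<-trans 0≤x x<0) (<-irrefl refl)

-- 0 ≤ c is what keeps the smaller factor positive.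
shrink : ∀ {x y c} → 0ℚ < x → 0ℚ ≤ c → c < x * y → ∃[ z ] (0ℚ < z × z < y × c < x * z)
shrink {x} {y} {c} 0<x 0≤c c<xy =
  let instance
        x⁺ : Positive x
        x⁺ = positive 0<x
        x≢0 : ℚ.NonZero x
        x≢0 = pos⇒nonZero x
      z , c/x<z , z<y = <-dense (*-cancelˡ-<-nonNeg x {{pos⇒nonNeg x}} {1/ x * c} {y}
                                   (subst (_< x * y) (sym (x*c/x x c)) c<xy))
      c<xz = subst (_< x * z) (x*c/x x c) (*-monoʳ-<-pos x c/x<z)
      0<z  = *-cancelˡ-<-nonNeg x {{pos⇒nonNeg x}} {0ℚ} {z}
               (≤-<-trans (≤-trans (≤-reflexive (*-zeroʳ x)) 0≤c) c<xz)
  in z , 0<z , z<y , c<xz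

^-open-above : ∀ {q c} n → 0ℚ ≤ q → q ^ n < c → ∃[ r ] (q < r × r ^ n < c)
^-open-above {q} {c} zero    0≤q 1<c = q + 1ℚ , q<q+1 q , 1<c
^-open-above {q} {c} (suc n) 0≤q p =
  let y , qⁿ<y , qy<c = enlarge 0≤q p
      0≤y = ≤-trans (^-nonNeg n 0≤q) (<⇒≤ qⁿ<y)
      x , q<x , yx<c = enlarge 0≤y (subst (_< c) (*-comm q y) qy<c)
      s , q<s , sⁿ<y = ^-open-above n 0≤q qⁿ<y
      r = s ⊓ x
      q<r = [ (λ e → subst (q <_) (sym e) q<s) , (λ e → subst (q <_) (sym e) q<x) ]′ (⊓-sel s x)
      0≤r = ≤-trans 0≤q (<⇒≤ q<r)
  in r , q<r , ≤-<-trans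
       (*-mono-≤-nonNeg (≤-trans 0≤q (<⇒≤ q<x)) (^-nonNeg n 0≤r) (p⊓q≤q s x)
         (≤-trans (^-mono-≤ n 0≤r (p⊓q≤p s x)) (<⇒≤ sⁿ<y)))
       (subst (_< c) (*-comm y x) yx<c)

^-open-below : ∀ {q c} n → 0ℚ < q → 0ℚ ≤ c → c < q ^ n → ∃[ r ] (0ℚ < r × r < q × c < r ^ n)
^-open-below {q} {c} zero 0<q 0≤c c<1 =
  let r , 0<r , r<q = <-dense 0<q in r , 0<r , r<q , c<1
^-open-below {q} {c} (suc n) 0<q 0≤c p =
  let y , 0<y , y<qⁿ , c<qy = shrink 0<q 0≤c p
      x , 0<x , x<q , c<yx = shrink 0<y 0≤c (subst (c <_) (*-comm q y) c<qy)
      s , 0<s , s<q , y<sⁿ = ^-open-below n 0<q (<⇒≤ 0<y) y<qⁿ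
      r = s ⊔ x
      r<q = [ (λ e → subst (_< q) (sym e) s<q) , (λ e → subst (_< q) (sym e) x<q) ]′ (⊔-sel s x)
      0<r = <-≤-trans 0<s (p≤p⊔q s x)
  in r , 0<r , r<q , <-≤-trans (subst (c <_) (*-comm y x) c<yx)
       (*-mono-≤-nonNeg (<⇒≤ 0<r) (<⇒≤ 0<y) (p≤q⊔p s x)
         (≤-trans (<⇒≤ y<sⁿ) (^-mono-≤ n (<⇒≤ 0<s) (p≤p⊔q s x))))

0≤fromℕ : ∀ a → 0ℚ ≤ + a / 1
0≤fromℕ a = nonNegative⁻¹ (+ a / 1) {{normalize-nonNeg a 1}}

a<[a+1]^n : ∀ a n .{{_ : NonZero n}} → 0ℚ ≤ a → a < (a + 1ℚ) ^ n
a<[a+1]^n a (suc n) 0≤a = <-≤-trans (q<q+1 a)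
  (subst (_≤ (a + 1ℚ) ^ suc n) (*-identityʳ (a + 1ℚ))
    (*-monoˡ-≤-nonNeg (a + 1ℚ) {{nonNegative 0≤a+1}} (1≤ n)))
  where
  0≤a+1 : 0ℚ ≤ a + 1ℚ
  0≤a+1 = ≤-trans 0≤a (<⇒≤ (q<q+1 a))
  1^ : ∀ n → 1ℚ ^ n ≡ 1ℚ
  1^ zero    = refl
  1^ (suc n) = trans (*-identityˡ (1ℚ ^ n)) (1^ n)
  1≤ : ∀ n → 1ℚ ≤ (a + 1ℚ) ^ n
  1≤ n = subst (_≤ (a + 1ℚ) ^ n) (1^ n)
    (^-mono-≤ n (nonNegative⁻¹ 1ℚ) (subst (_≤ a + 1ℚ) (+-identityˡ 1ℚ) (+-monoˡ-≤ 1ℚ 0≤a)))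

-- The nonnegative n-th root of a.  Negative q are put below the root separately,
-- since q ^ n may be positive when n is even.
root : (n : ℕ) .{{_ : NonZero n}} → ℕ → ℝ
root n a = record
  { L        = Lo
  ; U        = Up
  ; L-inhab  = - 1ℚ , inj₁ (negative⁻¹ (- 1ℚ))
  ; U-inhab  = a′ + 1ℚ , ≤-<-trans 0≤a (q<q+1 a′) , a<[a+1]^n a′ n 0≤a
  ; L-lower  = lower
  ; L-open   = open-L
  ; U-upper  = λ q<r (0<q , p) → <-trans 0<q q<r , <-trans p (^-mono-< n (<⇒≤ 0<q) q<r)
  ; U-open   = λ (0<r , p) → let q , 0<q , q<r , p′ = ^-open-below n 0<r 0≤a p in q , q<r , 0<q , p′
  ; disjoint = disj
  ; located  = loc
  }
  where
  a′ : ℚ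
  a′ = + a / 1
  0≤a : 0ℚ ≤ a′
  0≤a = 0≤fromℕ a
  Lo Up : ℚ → Set
  Lo q = q < 0ℚ ⊎ q ^ n < a′
  Up q = 0ℚ < q × a′ < q ^ n

  lower : ∀ {q r} → q < r → Lo r → Lo q
  lower {q} q<r l with q <? 0ℚ | l
  ... | yes q<0 | _        = inj₁ q<0
  ... | no  _   | inj₁ r<0 = inj₁ (<-trans q<r r<0)
  ... | no  q≮0 | inj₂ p   = inj₂ (<-trans (^-mono-< n (≮⇒≥ q≮0) q<r) p)

  open-L : ∀ {q} → Lo q → ∃[ r ] (q < r × Lo r)
  open-L {q} l with q <? 0ℚ | l
  ... | yes q<0 | _        = let r , q<r , r<0 = <-dense q<0 in r , q<r , inj₁ r<0
  ... | no  q≮0 | inj₁ q<0 = contradiction q<0 q≮0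
  ... | no  q≮0 | inj₂ p   = let r , q<r , p′ = ^-open-above n (≮⇒≥ q≮0) p in r , q<r , inj₂ p′

  disj : ∀ {q} → Lo q → Up q → ⊥
  disj (inj₁ q<0) (0<q , _) = <-asym q<0 0<q
  disj (inj₂ p)   (_ , p′)  = <-asym p p′

  loc : ∀ {q r} → q < r → Lo q ⊎ Up r
  loc {q} {r} q<r with q <? 0ℚ | q ^ n <? a′
  ... | yes q<0 | _     = inj₁ (inj₁ q<0)
  ... | no  _   | yes p = inj₁ (inj₂ p)
  ... | no  q≮0 | no ¬p = inj₂ ( ≤-<-trans (≮⇒≥ q≮0) q<r
                               , ≤-<-trans (≮⇒≥ ¬p) (^-mono-< n (≮⇒≥ q≮0) q<r) )

Sequence : Set₁
Sequence = (n : ℕ) .{{_ : NonZero n}} → ℝ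

ConvergesTo : Sequence → ℝ → Set
ConvergesTo x ℓ = ∀ ε → 0ℚ < ε →
  ∃[ N ] (∀ n .{{_ : NonZero n}} → N ℕ.≤ n → x n <ℝ ℓ +ℚ ε × ℓ <ℝ x n +ℚ ε)

-- The ε-characterization of lim sup x = ℓ for finite ℓ: beyond every ℓ + ε only
-- finitely many terms, beyond every ℓ - ε infinitely many.
IsLimSup : Sequence → ℝ → Set
IsLimSup x ℓ = ∀ ε → 0ℚ < ε →
  (∃[ N ] (∀ n .{{_ : NonZero n}} → N ℕ.≤ n → x n <ℝ ℓ +ℚ ε)) ×
  (∀ N → ∃[ n ] ∃[ n≢0 ] (N ℕ.≤ n × ℓ <ℝ x n {{n≢0}} +ℚ ε))

m^m≢0 : ∀ m → NonZero (m ℕ.^ m)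
m^m≢0 zero    = _
m^m≢0 (suc m) = ℕ.m^n≢0 (suc m) (suc m)

-- k^(k+1) / (k-1)^(k-1); 0 ^ 0 computes to 1.
growthRate : (k : ℕ) .{{_ : NonZero k}} → ℚ
growthRate k = _/_ (+ (k ℕ.^ suc k)) (ℕ.pred k ℕ.^ ℕ.pred k) {{m^m≢0 (ℕ.pred k)}}

{-# OPTIONS --safe #-}

-- Colour a word so that each colour class is strictly decreasing.  With k colours this
-- is possible exactly when there is no weakly increasing subsequence of length k + 1,
-- so w̄ n k is at most the number A n of coloured words of length n with letters in
-- [n].  Conversely t coloured words of length N can be stacked into one avoiding word:
-- letter v of colour c in the block followed by t′ others becomes v + (t′ + c) N.
-- Position and value then determine t′, c and v, so that A N ^ t ≤ w̄ ((t + k) N) k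
-- after padding, and w̄ n k and A n have the same growth rate.
--
-- Choosing the colours of the positions and then the letters of each colour gives
-- A n ≤ k ^ n · C(k n, n), and for N = k B the choices that use every colour B times give
-- A N ≥ N! / B! ^ k · C(N, B) ^ k.  Both equal (k ^ (k + 1) / (k - 1) ^ (k - 1)) ^ n up to
-- a factor polynomial in n.
module Submission where

open import Defs
open import Algebra.Bundles using (CommutativeMonoid; CommutativeRing)
import Algebra.Properties.CommutativeSemiring.Exp
import Algebra.Properties.Monoid.Sum
import Algebra.Properties.Semiring.Exp
import Algebra.Properties.Semiring.Sum
open import Data.Fin using (Fin; zero; suc; toℕ; fromℕ<; finToFun; funToFin)
import Data.Fin as Fin
import Data.Fin.Properties as Fin
import Data.Integer as ℤ
import Data.Integer.Properties as ℤ
open import Data.List using (List; []; _∷_; [_]; _++_; length; map; concat; tabulate; lookup; filter; allFin; applyDownFrom; cartesianProduct)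
open import Data.List.Membership.Propositional using (_∈_)
open import Data.List.Membership.Propositional.Properties
open import Data.List.Properties
  using (length-++; length-map; length-applyDownFrom; length-tabulate; map-∘; map-++; map-tabulate; tabulate-cong; tabulate-lookup; ∷-injective; ∷-injectiveˡ; ∷-injectiveʳ)
open import Data.List.Relation.Binary.Subset.Propositional using (_⊆_)
open import Data.List.Relation.Unary.All as All using (All; []; _∷_)
import Data.List.Relation.Unary.All.Properties as All
open import Data.List.Relation.Unary.AllPairs as AllPairs using (AllPairs; []; _∷_)
import Data.List.Relation.Unary.AllPairs.Properties as AllPairs
open import Data.List.Relation.Unary.Any as Any using (here; there)
open import Data.List.Relation.Unary.Any.Properties using (lookup-index)
open import Data.List.Relation.Unary.Unique.Propositional using (Unique)
import Data.List.Relation.Unary.Unique.Propositional.Properties as Unique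
open import Data.Nat using (ℕ; zero; suc; NonZero)
import Data.Nat as ℕ
open import Data.Nat.Combinatorics using (_C_; nCk+nC[k+1]≡[n+1]C[k+1]; nCk≡n!/k![n-k]!; k![n∸k]!∣n!; k>n⇒nCk≡0)
open import Data.Nat.DivMod using (_%_; m/n*n≡m; [m+kn]%n≡m%n; m<n⇒m%n≡m)
import Data.Nat.DivMod as ℕ
import Data.Nat.Properties as ℕ
open import Data.Nat.Tactic.RingSolver using (solve-∀)
open import Data.Product using (∃-syntax; Σ-syntax; ∃₂; _×_; _,_; proj₁; proj₂)
import Data.Rational as ℚ
import Data.Rational.Unnormalised as ℚᵘ
import Data.Rational.Unnormalised.Properties as ℚᵘ
open import Data.Sum using (_⊎_; inj₁; inj₂; [_,_]′)
open import Data.Vec.Functional using (updateAt)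
open import Data.Vec.Functional.Properties using (updateAt-updates; updateAt-minimal)
open import Function using (_∘_; id; const; case_of_; _⇔_; mk⇔; Equivalence)
open import Relation.Binary using (tri<; tri≈; tri>)
open import Relation.Binary.PropositionalEquality hiding (setoid; isEquivalence; [_])
open import Relation.Nullary using (¬_; Dec; yes; no; contradiction)
open import Relation.Nullary.Decidable using (¬?)

infixl 30 _[_≔_]
_[_≔_] : ∀ {a} {A : Set a} {k} → (Fin k → A) → Fin k → A → Fin k → A
f [ c ≔ x ] = updateAt f c (const x)

-- Counting coloured words

module _ where
  open import Data.Nat using (_+_; _*_; _∸_; _≤_; _<_; z≤n; s≤s; _!)
  module _ {ℓ₁ ℓ₂} (M : CommutativeMonoid ℓ₁ ℓ₂) where
    open CommutativeMonoid M hiding (refl; sym; trans)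
    open Algebra.Properties.Monoid.Sum monoid using (sum; sum-cong-≋)
    open import Algebra.Properties.CommutativeSemigroup commutativeSemigroup using (x∙yz≈y∙xz)
    open import Relation.Binary.Reasoning.Setoid setoid

    -- Allowing two functions lets `f` be `g` with slot `c` overwritten: whatever stands there, the
    -- rest is the same `sum (g [ c ≔ ε ])`. It is stated for any commutative monoid because both
    -- sums and products over the colours are split this way.
    sum-extract : ∀ {k} c {f g : Fin k → Carrier} → (∀ j → j ≢ c → f j ≈ g j) →
                  sum f ≈ f c ∙ sum (g [ c ≔ ε ])
    sum-extract zero {f} {g} f≈g = ∙-congˡ (begin
      sum (f ∘ suc)      ≈⟨ sum-cong-≋ (λ j → f≈g (suc j) λ ()) ⟩
      sum (g ∘ suc)      ≈⟨ identityˡ _ ⟨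
      ε ∙ sum (g ∘ suc)  ∎)
    sum-extract (suc c) {f} {g} f≈g = begin
      f zero ∙ sum (f ∘ suc)                              ≈⟨ ∙-cong (f≈g zero λ ()) (sum-extract c λ j j≢c → f≈g (suc j) (j≢c ∘ Fin.suc-injective)) ⟩
      g zero ∙ (f (suc c) ∙ sum ((g ∘ suc) [ c ≔ ε ]))    ≈⟨ x∙yz≈y∙xz _ _ _ ⟩
      f (suc c) ∙ (g zero ∙ sum ((g ∘ suc) [ c ≔ ε ]))    ∎

  open Algebra.Properties.Semiring.Sum ℕ.+-*-semiring using (sum; *-distribʳ-sum)
  open Algebra.Properties.Monoid.Sum ℕ.*-1-monoid using ()
    renaming (sum to product; sum-cong-≗ to product-cong)

  ∑< : ℕ → (ℕ → ℕ) → ℕ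
  ∑< zero    f = 0
  ∑< (suc p) f = f p + ∑< p f

  -- After a letter v of colour c, the later letters of colour c are below v.
  count : ∀ {k} → ℕ → (Fin k → ℕ) → ℕ
  count zero    m = 1
  count (suc n) m = sum λ c → ∑< (m c) λ v → count n (m [ c ≔ v ])

  open ℕ.≤-Reasoning

  sum-mono : ∀ {k} {f g : Fin k → ℕ} → (∀ j → f j ≤ g j) → sum f ≤ sum g
  sum-mono {zero}  f≤g = z≤n
  sum-mono {suc k} f≤g = ℕ.+-mono-≤ (f≤g zero) (sum-mono (f≤g ∘ suc))

  sum-const : ∀ k x → sum {k} (const x) ≡ k * x
  sum-const zero    x = refl
  sum-const (suc k) x = cong (x +_) (sum-const k x)

  product-const : ∀ k x → product {k} (const x) ≡ x ℕ.^ k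
  product-const zero    x = refl
  product-const (suc k) x = cong (x *_) (product-const k x)

  sum≡0⇒≡0 : ∀ {k} (f : Fin k → ℕ) → sum f ≡ 0 → ∀ j → f j ≡ 0
  sum≡0⇒≡0 f eq zero    = ℕ.m+n≡0⇒m≡0 (f zero) eq
  sum≡0⇒≡0 f eq (suc j) = sum≡0⇒≡0 (f ∘ suc) (ℕ.m+n≡0⇒n≡0 (f zero) eq) j

  -- The hockey-stick identity, by which the binomials `v C β` with `v < p` add up to `p C suc β`,
  -- with denominators cleared. In `count-lower`, `x` is the factorial of the remaining length,
  -- while `r` and `y` collect the binomials and factorials of the other colours.
  ∑<-scaled-lower : ∀ β x r y (g : ℕ → ℕ) → (∀ v → x * ((v C β) * r) ≤ g v * (β ! * y)) →
    ∀ p → suc β * (x * ((p C suc β) * r)) ≤ ∑< p g * (suc β ! * y)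
  ∑<-scaled-lower β x r y g bound zero = ℕ.≤-reflexive (lemma (suc β) x)
    where
    lemma : ∀ a b → a * (b * 0) ≡ 0
    lemma = solve-∀
  ∑<-scaled-lower β x r y g bound (suc p) = begin
    suc β * (x * ((suc p C suc β) * r))
      ≡⟨ cong (λ z → suc β * (x * (z * r))) (nCk+nC[k+1]≡[n+1]C[k+1] p β) ⟨
    suc β * (x * ((p C β + p C suc β) * r))
      ≡⟨ distrib (suc β) x (p C β) (p C suc β) r ⟩
    suc β * (x * ((p C β) * r)) + suc β * (x * ((p C suc β) * r))
      ≤⟨ ℕ.+-mono-≤ (ℕ.*-monoʳ-≤ (suc β) (bound p)) (∑<-scaled-lower β x r y g bound p) ⟩
    suc β * (g p * (β ! * y)) + ∑< p g * (suc β ! * y)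
      ≡⟨ collect (suc β) (g p) (β !) y (∑< p g) ⟩
    (g p + ∑< p g) * (suc β ! * y) ∎
    where
    distrib : ∀ a b c d e → a * (b * ((c + d) * e)) ≡ a * (b * (c * e)) + a * (b * (d * e))
    distrib = solve-∀
    collect : ∀ a b c d e → a * (b * (c * d)) + e * (a * c * d) ≡ (b + e) * (a * c * d)
    collect = solve-∀

  -- There are `n ! / ∏ b j !` ways to place the colours when colour `j` occurs `b j` times, and its
  -- letters are then a `b j`-element set of values below `m j` in decreasing order. The induction
  -- splits the factor `suc n` as `sum b`, colour `c` of the first letter receiving the share `b c`;
  -- summing over that letter is the hockey-stick identity.
  count-lower : ∀ {k} n (m b : Fin k → ℕ) → sum b ≡ n →
    n ! * product (λ j → m j C b j) ≤ count n m * product (λ j → b j !)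
  count-lower {k} zero m b eq = ℕ.≤-reflexive (cong (1 *_) (trans
      (product-cong (λ j → cong (m j C_) (b≡0 j)))
      (sym (product-cong (λ j → cong _! (b≡0 j))))))
    where
    b≡0 = sum≡0⇒≡0 b eq
  count-lower {k} (suc n) m b eq = begin
    suc n ! * binomials                      ≡⟨ ℕ.*-assoc (suc n) (n !) binomials ⟩
    suc n * (n ! * binomials)                ≡⟨ cong (_* (n ! * binomials)) eq ⟨
    sum b * (n ! * binomials)                ≡⟨ *-distribʳ-sum (n ! * binomials) b ⟩
    sum (λ c → b c * (n ! * binomials))      ≤⟨ sum-mono (λ c → letter c (b c) refl) ⟩
    sum (λ c → ∑< (m c) (g c) * factorials)  ≡⟨ *-distribʳ-sum factorials (λ c → ∑< (m c) (g c)) ⟨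
    count (suc n) m * factorials             ∎
    where
    binomials  = product (λ j → m j C b j)
    factorials = product (λ j → b j !)
    g : Fin k → ℕ → ℕ
    g c v = count n (m [ c ≔ v ])
    letter : ∀ c β → b c ≡ β → β * (n ! * binomials) ≤ ∑< (m c) (g c) * factorials
    letter c zero    bc≡0 = z≤n
    letter c (suc β) bc≡suc = begin
      suc β * (n ! * binomials)                  ≡⟨ cong (λ z → suc β * (n ! * z)) binomials≡ ⟩
      suc β * (n ! * ((m c C suc β) * r))        ≤⟨ ∑<-scaled-lower β (n !) r y (g c) bound (m c) ⟩
      ∑< (m c) (g c) * (suc β ! * y)             ≡⟨ cong (∑< (m c) (g c) *_) factorials≡ ⟨
      ∑< (m c) (g c) * factorials                ∎
      where
      r = product ((λ j → m j C b j) [ c ≔ 1 ])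
      y = product ((λ j → b j !) [ c ≔ 1 ])
      binomials≡ : binomials ≡ (m c C suc β) * r
      binomials≡ = trans (sum-extract ℕ.*-1-commutativeMonoid c λ _ _ → refl) (cong (λ z → (m c C z) * r) bc≡suc)
      factorials≡ : factorials ≡ suc β ! * y
      factorials≡ = trans (sum-extract ℕ.*-1-commutativeMonoid c λ _ _ → refl) (cong (λ z → z ! * y) bc≡suc)
      b′ : Fin k → ℕ
      b′ = b [ c ≔ β ]
      sum-b′ : sum b′ ≡ n
      sum-b′ = ℕ.suc-injective (begin-equality
        suc (sum b′)                  ≡⟨ cong suc (sum-extract ℕ.+-0-commutativeMonoid c (λ j j≢c → updateAt-minimal j c b j≢c)) ⟩
        suc (b′ c + sum (b [ c ≔ 0 ]))  ≡⟨ cong (λ z → suc (z + sum (b [ c ≔ 0 ]))) (updateAt-updates c b) ⟩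
        suc β + sum (b [ c ≔ 0 ])     ≡⟨ cong (_+ sum (b [ c ≔ 0 ])) bc≡suc ⟨
        b c + sum (b [ c ≔ 0 ])       ≡⟨ sum-extract ℕ.+-0-commutativeMonoid c {b} (λ _ _ → refl) ⟨
        sum b                         ≡⟨ eq ⟩
        suc n                         ∎)
      bound : ∀ v → n ! * ((v C β) * r) ≤ g c v * (β ! * y)
      bound v = begin
        n ! * ((v C β) * r)                                ≡⟨ cong₂ (λ u w → n ! * ((u C w) * r)) (updateAt-updates c m) (updateAt-updates c b) ⟨
        n ! * (((m [ c ≔ v ]) c C b′ c) * r)               ≡⟨ cong (n ! *_) (sum-extract ℕ.*-1-commutativeMonoid c λ j j≢c → cong₂ _C_ (updateAt-minimal j c m j≢c) (updateAt-minimal j c b j≢c)) ⟨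
        n ! * product (λ j → (m [ c ≔ v ]) j C b′ j)       ≤⟨ count-lower n (m [ c ≔ v ]) b′ sum-b′ ⟩
        g c v * product (λ j → b′ j !)                     ≡⟨ cong (g c v *_) (sum-extract ℕ.*-1-commutativeMonoid c λ j j≢c → cong _! (updateAt-minimal j c b j≢c)) ⟩
        g c v * (b′ c ! * y)                               ≡⟨ cong (λ z → g c v * (z ! * y)) (updateAt-updates c b) ⟩
        g c v * (β ! * y)                                  ∎

  -- There are `k ^ n` colour sequences, and the coloured letters form an `n`-element subset of a
  -- disjoint union of `sum m` elements. In the induction, a first letter `v` of colour `c` leaves a
  -- union of size `v + r`, and Pascal's rule adds up the bounds over `v`.
  count-upper : ∀ {k} n (m : Fin k → ℕ) → count n m ≤ k ℕ.^ n * (sum m C n)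
  count-upper zero    m = ℕ.≤-refl
  count-upper {k} (suc n) m = begin
    sum (λ c → ∑< (m c) (λ v → count n (m [ c ≔ v ])))  ≤⟨ sum-mono letter ⟩
    sum {k} (const (k ℕ.^ n * (sum m C suc n)))         ≡⟨ sum-const k _ ⟩
    k * (k ℕ.^ n * (sum m C suc n))                     ≡⟨ ℕ.*-assoc k _ _ ⟨
    k ℕ.^ suc n * (sum m C suc n)                       ∎
    where
    letter : ∀ c → ∑< (m c) (λ v → count n (m [ c ≔ v ])) ≤ k ℕ.^ n * (sum m C suc n)
    letter c = begin
      ∑< (m c) (λ v → count n (m [ c ≔ v ]))  ≤⟨ partial (m c) ⟩
      k ℕ.^ n * ((m c + r) C suc n)           ≡⟨ cong (λ z → k ℕ.^ n * (z C suc n)) (sum-extract ℕ.+-0-commutativeMonoid c {m} (λ _ _ → refl)) ⟨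
      k ℕ.^ n * (sum m C suc n)               ∎
      where
      r = sum (m [ c ≔ 0 ])
      sum≡ : ∀ v → sum (m [ c ≔ v ]) ≡ v + r
      sum≡ v = trans (sum-extract ℕ.+-0-commutativeMonoid c (λ j j≢c → updateAt-minimal j c m j≢c)) (cong (_+ r) (updateAt-updates c m))
      partial : ∀ p → ∑< p (λ v → count n (m [ c ≔ v ])) ≤ k ℕ.^ n * ((p + r) C suc n)
      -- The telescoping sum starts at `r C suc n`, which is simply dropped.
      partial zero    = z≤n
      partial (suc p) = begin
        count n (m [ c ≔ p ]) + ∑< p (λ v → count n (m [ c ≔ v ]))
          ≤⟨ ℕ.+-mono-≤ (count-upper n (m [ c ≔ p ])) (partial p) ⟩
        k ℕ.^ n * (sum (m [ c ≔ p ]) C n) + k ℕ.^ n * ((p + r) C suc n)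
          ≡⟨ cong (λ z → k ℕ.^ n * (z C n) + k ℕ.^ n * ((p + r) C suc n)) (sum≡ p) ⟩
        k ℕ.^ n * ((p + r) C n) + k ℕ.^ n * ((p + r) C suc n)
          ≡⟨ ℕ.*-distribˡ-+ (k ℕ.^ n) _ _ ⟨
        k ℕ.^ n * ((p + r) C n + (p + r) C suc n)
          ≡⟨ cong (k ℕ.^ n *_) (nCk+nC[k+1]≡[n+1]C[k+1] (p + r) n) ⟩
        k ℕ.^ n * ((suc p + r) C suc n) ∎

  -- Binomial and factorial estimates on the diagonal

  nCk*x^[n∸k]≤[1+x]^n : ∀ x n k → (n C k) * x ℕ.^ (n ∸ k) ≤ suc x ℕ.^ n
  nCk*x^[n∸k]≤[1+x]^n x zero    zero    = ℕ.≤-refl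
  nCk*x^[n∸k]≤[1+x]^n x zero    (suc k) = z≤n
  nCk*x^[n∸k]≤[1+x]^n x (suc n) zero    = begin
    1 * (x * x ℕ.^ n)     ≡⟨ ℕ.*-identityˡ _ ⟩
    x ℕ.^ suc n           ≤⟨ ℕ.^-monoˡ-≤ (suc n) (ℕ.n≤1+n x) ⟩
    suc x ℕ.^ suc n       ∎
  nCk*x^[n∸k]≤[1+x]^n x (suc n) (suc k) = begin
    (suc n C suc k) * x ℕ.^ (n ∸ k)                            ≡⟨ cong (_* x ℕ.^ (n ∸ k)) (nCk+nC[k+1]≡[n+1]C[k+1] n k) ⟨
    (n C k + n C suc k) * x ℕ.^ (n ∸ k)                        ≡⟨ ℕ.*-distribʳ-+ (x ℕ.^ (n ∸ k)) (n C k) (n C suc k) ⟩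
    (n C k) * x ℕ.^ (n ∸ k) + (n C suc k) * x ℕ.^ (n ∸ k)      ≤⟨ ℕ.+-mono-≤ (nCk*x^[n∸k]≤[1+x]^n x n k) second ⟩
    suc x ℕ.^ n + x * suc x ℕ.^ n                              ∎
    where
    second : (n C suc k) * x ℕ.^ (n ∸ k) ≤ x * suc x ℕ.^ n
    second with k ℕ.<? n
    ... | yes k<n = begin
      (n C suc k) * x ℕ.^ (n ∸ k)              ≡⟨ cong (λ z → (n C suc k) * x ℕ.^ z) (ℕ.+-∸-assoc 1 k<n) ⟩
      (n C suc k) * (x * x ℕ.^ (n ∸ suc k))    ≡⟨ swap (n C suc k) x _ ⟩
      x * ((n C suc k) * x ℕ.^ (n ∸ suc k))    ≤⟨ ℕ.*-monoʳ-≤ x (nCk*x^[n∸k]≤[1+x]^n x n (suc k)) ⟩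
      x * suc x ℕ.^ n                          ∎
      where
      swap : ∀ a b c → a * (b * c) ≡ b * (a * c)
      swap = solve-∀
    -- Here truncated subtraction no longer lowers the exponent, but the coefficient vanishes.
    ... | no k≮n rewrite k>n⇒nCk≡0 {n} {suc k} (s≤s (ℕ.≮⇒≥ k≮n)) = z≤n

  module _ (k-1 : ℕ) where
    private
      k = suc k-1

    diagonal : ℕ → ℕ
    diagonal n = count {k} n (const n)

    -- The power of `k-1` turns the binomial `k * n C n` into a single term of the expansion of
    -- `(1 + k-1) ^ (k * n)`.
    diagonal-upper : ∀ n → diagonal n * k-1 ℕ.^ (k-1 * n) ≤ k ℕ.^ (suc k * n)
    diagonal-upper n = begin
      diagonal n * k-1 ℕ.^ (k-1 * n)                     ≤⟨ ℕ.*-monoˡ-≤ _ (count-upper n (const n)) ⟩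
      k ℕ.^ n * (sum {k} (const n) C n) * k-1 ℕ.^ (k-1 * n)
        ≡⟨ cong₂ (λ u v → k ℕ.^ n * (u C n) * k-1 ℕ.^ v) (sum-const k n) (sym (ℕ.m+n∸m≡n n (k-1 * n))) ⟩
      k ℕ.^ n * (k * n C n) * k-1 ℕ.^ (k * n ∸ n)        ≡⟨ ℕ.*-assoc (k ℕ.^ n) _ _ ⟩
      k ℕ.^ n * ((k * n C n) * k-1 ℕ.^ (k * n ∸ n))      ≤⟨ ℕ.*-monoʳ-≤ (k ℕ.^ n) (nCk*x^[n∸k]≤[1+x]^n k-1 (k * n) n) ⟩
      k ℕ.^ n * k ℕ.^ (k * n)                            ≡⟨ ℕ.^-distribˡ-+-* k n (k * n) ⟨
      k ℕ.^ (suc k * n)                                  ∎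

  [a+n]!≤[a+n]^a*n! : ∀ a n → (a + n) ! ≤ (a + n) ℕ.^ a * n !
  [a+n]!≤[a+n]^a*n! zero    n = ℕ.≤-reflexive (sym (ℕ.*-identityˡ (n !)))
  [a+n]!≤[a+n]^a*n! (suc a) n = begin
    suc (a + n) * (a + n) !                        ≤⟨ ℕ.*-monoʳ-≤ (suc (a + n)) ([a+n]!≤[a+n]^a*n! a n) ⟩
    suc (a + n) * ((a + n) ℕ.^ a * n !)            ≤⟨ ℕ.*-monoʳ-≤ (suc (a + n)) (ℕ.*-monoˡ-≤ (n !) (ℕ.^-monoˡ-≤ a (ℕ.n≤1+n (a + n)))) ⟩
    suc (a + n) * (suc (a + n) ℕ.^ a * n !)        ≡⟨ ℕ.*-assoc (suc (a + n)) (suc (a + n) ℕ.^ a) (n !) ⟨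
    suc (a + n) ℕ.^ suc a * n !                    ∎

  n!*n^a≤[a+n]! : ∀ a n → n ! * n ℕ.^ a ≤ (a + n) !
  n!*n^a≤[a+n]! zero    n = ℕ.≤-reflexive (ℕ.*-identityʳ (n !))
  n!*n^a≤[a+n]! (suc a) n = begin
    n ! * (n * n ℕ.^ a)      ≡⟨ swap (n !) n (n ℕ.^ a) ⟩
    n * (n ! * n ℕ.^ a)      ≤⟨ ℕ.*-mono-≤ (ℕ.m≤n+m n (suc a)) (n!*n^a≤[a+n]! a n) ⟩
    suc (a + n) * (a + n) !  ∎
    where
    swap : ∀ a b c → a * (b * c) ≡ b * (a * c)
    swap = solve-∀

  [m*n]^k : ∀ k m n → (m * n) ℕ.^ k ≡ m ℕ.^ k * n ℕ.^ k
  [m*n]^k zero    m n = refl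
  [m*n]^k (suc k) m n = trans (cong (m * n *_) ([m*n]^k k m n)) (interchange m n (m ℕ.^ k) (n ℕ.^ k))
    where
    interchange : ∀ a b c d → a * b * (c * d) ≡ a * c * (b * d)
    interchange = solve-∀

  -- The multinomial coefficient `(a n)! / n! ^ a` is at most `a ^ (a n)`: each step from `n` to
  -- `suc n` adds `a` factors to the factorial, none above `a * suc n`.
  [a*n]!≤n!^a*a^[a*n] : ∀ a n → (a * n) ! ≤ (n !) ℕ.^ a * a ℕ.^ (a * n)
  [a*n]!≤n!^a*a^[a*n] a zero rewrite ℕ.*-zeroʳ a | ℕ.^-zeroˡ a = ℕ.≤-refl
  [a*n]!≤n!^a*a^[a*n] a (suc n) = begin
    (a * suc n) !                                                  ≡⟨ cong _! (ℕ.*-suc a n) ⟩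
    (a + a * n) !                                                  ≤⟨ [a+n]!≤[a+n]^a*n! a (a * n) ⟩
    (a + a * n) ℕ.^ a * (a * n) !                                  ≤⟨ ℕ.*-monoʳ-≤ ((a + a * n) ℕ.^ a) ([a*n]!≤n!^a*a^[a*n] a n) ⟩
    (a + a * n) ℕ.^ a * ((n !) ℕ.^ a * a ℕ.^ (a * n))                ≡⟨ cong (λ z → z ℕ.^ a * ((n !) ℕ.^ a * a ℕ.^ (a * n))) (ℕ.*-suc a n) ⟨
    (a * suc n) ℕ.^ a * ((n !) ℕ.^ a * a ℕ.^ (a * n))                ≡⟨ cong (_* ((n !) ℕ.^ a * a ℕ.^ (a * n))) ([m*n]^k a a (suc n)) ⟩
    a ℕ.^ a * suc n ℕ.^ a * ((n !) ℕ.^ a * a ℕ.^ (a * n))            ≡⟨ regroup (a ℕ.^ a) (suc n ℕ.^ a) ((n !) ℕ.^ a) (a ℕ.^ (a * n)) ⟩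
    (suc n ℕ.^ a * (n !) ℕ.^ a) * (a ℕ.^ a * a ℕ.^ (a * n))          ≡⟨ cong₂ _*_ (sym ([m*n]^k a (suc n) (n !))) (sym (ℕ.^-distribˡ-+-* a a (a * n))) ⟩
    (suc n !) ℕ.^ a * a ℕ.^ (a + a * n)                              ≡⟨ cong (λ z → (suc n !) ℕ.^ a * a ℕ.^ z) (ℕ.*-suc a n) ⟨
    (suc n !) ℕ.^ a * a ℕ.^ (a * suc n)                              ∎
    where
    regroup : ∀ p q r s → p * q * (r * s) ≡ (q * r) * (p * s)
    regroup = solve-∀

  -- The same multinomial coefficient is smaller than `a ^ (a n)` by a factor of at most
  -- `(a n) ^ a`. In the induction the old error `(a n) ^ a` is absorbed by the `a` new factors of
  -- the factorial. The start is at 1, since for positive `a` the right side vanishes at 0.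
  a^[a*n]*n!^a≤[a*n]!*[a*n]^a : ∀ a n .{{_ : NonZero n}} →
    a ℕ.^ (a * n) * (n !) ℕ.^ a ≤ (a * n) ! * (a * n) ℕ.^ a
  a^[a*n]*n!^a≤[a*n]!*[a*n]^a a (suc zero) rewrite ℕ.*-identityʳ a | ℕ.^-zeroˡ a = begin
    a ℕ.^ a * 1       ≡⟨ ℕ.*-comm (a ℕ.^ a) 1 ⟩
    1 * a ℕ.^ a       ≤⟨ ℕ.*-monoˡ-≤ (a ℕ.^ a) (ℕ.1≤n! a) ⟩
    a ! * a ℕ.^ a     ∎
  a^[a*n]*n!^a≤[a*n]!*[a*n]^a a (suc n@(suc _)) = begin
    a ℕ.^ (a * suc n) * (suc n !) ℕ.^ a                            ≡⟨ cong₂ _*_ (cong (a ℕ.^_) (ℕ.*-suc a n)) ([m*n]^k a (suc n) (n !)) ⟩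
    a ℕ.^ (a + a * n) * (suc n ℕ.^ a * (n !) ℕ.^ a)                ≡⟨ cong (_* (suc n ℕ.^ a * (n !) ℕ.^ a)) (ℕ.^-distribˡ-+-* a a (a * n)) ⟩
    a ℕ.^ a * a ℕ.^ (a * n) * (suc n ℕ.^ a * (n !) ℕ.^ a)          ≡⟨ regroup (a ℕ.^ a) (a ℕ.^ (a * n)) (suc n ℕ.^ a) ((n !) ℕ.^ a) ⟩
    a ℕ.^ (a * n) * (n !) ℕ.^ a * (a ℕ.^ a * suc n ℕ.^ a)          ≤⟨ ℕ.*-mono-≤ (a^[a*n]*n!^a≤[a*n]!*[a*n]^a a n) (ℕ.≤-reflexive (sym ([m*n]^k a a (suc n)))) ⟩
    (a * n) ! * (a * n) ℕ.^ a * (a * suc n) ℕ.^ a                ≤⟨ ℕ.*-monoˡ-≤ _ (n!*n^a≤[a+n]! a (a * n)) ⟩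
    (a + a * n) ! * (a * suc n) ℕ.^ a                            ≡⟨ cong (λ z → z ! * (a * suc n) ℕ.^ a) (ℕ.*-suc a n) ⟨
    (a * suc n) ! * (a * suc n) ℕ.^ a                            ∎
    where
    regroup : ∀ p q r s → p * q * (r * s) ≡ q * s * (p * r)
    regroup = solve-∀

  nCk*k!*[n∸k]! : ∀ {n k} → k ≤ n → (n C k) * (k ! * (n ∸ k) !) ≡ n !
  nCk*k!*[n∸k]! {n} {k} k≤n = trans (cong (_* (k ! * (n ∸ k) !)) (nCk≡n!/k![n-k]! k≤n)) (m/n*n≡m (k![n∸k]!∣n! k≤n))
    where instance _ = k ℕ.!* (n ∸ k) !≢0

  module _ (k-1 : ℕ) where
    private
      k = suc k-1

    -- Using every colour `B` times, `count-lower` supplies one factor `N !` for the arrangement and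
    -- one in each of the `k` binomials. The lower multinomial estimate therefore enters to the
    -- power `suc k`, and its error accumulates to `N ^ (k * suc k)`. The remaining factorials `g`
    -- are bounded by the upper estimate, and all powers of `B !` cancel.
    diagonal-lower : ∀ B .{{_ : NonZero B}} → let N = k * B in
      k ℕ.^ (suc k * N) ≤ diagonal k-1 N * k-1 ℕ.^ (k-1 * N) * N ℕ.^ (k * suc k)
    diagonal-lower B = ℕ.*-cancelʳ-≤ _ _ (f ℕ.^ (k * suc k)) {{ℕ.m^n≢0 f (k * suc k) {{B ℕ.!≢0}}}} (begin
      k ℕ.^ (suc k * N) * f ℕ.^ (k * suc k)
        ≡⟨ cong₂ _*_ (trans (cong (k ℕ.^_) (ℕ.*-comm (suc k) N)) (sym (ℕ.^-*-assoc k N (suc k)))) (sym (ℕ.^-*-assoc f k (suc k))) ⟩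
      (k ℕ.^ N) ℕ.^ suc k * (f ℕ.^ k) ℕ.^ suc k
        ≡⟨ [m*n]^k (suc k) (k ℕ.^ N) (f ℕ.^ k) ⟨
      (k ℕ.^ N * f ℕ.^ k) ℕ.^ suc k
        ≤⟨ ℕ.^-monoˡ-≤ (suc k) (a^[a*n]*n!^a≤[a*n]!*[a*n]^a k B) ⟩
      (N ! * N ℕ.^ k) ℕ.^ suc k
        ≡⟨ [m*n]^k (suc k) (N !) (N ℕ.^ k) ⟩
      N ! * (N !) ℕ.^ k * (N ℕ.^ k) ℕ.^ suc k
        ≡⟨ cong₂ (λ u v → N ! * u * v) N!^k (ℕ.^-*-assoc N k (suc k)) ⟩
      N ! * (binomial ℕ.^ k * (f ℕ.^ k * g ℕ.^ k)) * N ℕ.^ (k * suc k)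
        ≡⟨ regroup₁ (N !) (binomial ℕ.^ k) (f ℕ.^ k) (g ℕ.^ k) (N ℕ.^ (k * suc k)) ⟩
      N ! * binomial ℕ.^ k * (f ℕ.^ k * g ℕ.^ k * N ℕ.^ (k * suc k))
        ≤⟨ ℕ.*-mono-≤ main (ℕ.*-monoˡ-≤ _ (ℕ.*-monoʳ-≤ (f ℕ.^ k) g^k)) ⟩
      d * f ℕ.^ k * (f ℕ.^ k * (f ℕ.^ (k-1 * k) * k-1 ℕ.^ (k-1 * N)) * N ℕ.^ (k * suc k))
        ≡⟨ regroup₂ d (f ℕ.^ k) (f ℕ.^ (k-1 * k)) (k-1 ℕ.^ (k-1 * N)) (N ℕ.^ (k * suc k)) ⟩
      d * k-1 ℕ.^ (k-1 * N) * N ℕ.^ (k * suc k) * (f ℕ.^ k * (f ℕ.^ k * f ℕ.^ (k-1 * k)))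
        ≡⟨ cong (d * k-1 ℕ.^ (k-1 * N) * N ℕ.^ (k * suc k) *_) f-powers ⟩
      d * k-1 ℕ.^ (k-1 * N) * N ℕ.^ (k * suc k) * f ℕ.^ (k * suc k) ∎)
      where
      N = k * B
      f = B !
      g = (k-1 * B) !
      d = diagonal k-1 N
      binomial = N C B
      main : N ! * binomial ℕ.^ k ≤ d * f ℕ.^ k
      main = subst₂ (λ u v → N ! * u ≤ d * v) (product-const k binomial) (product-const k f)
               (count-lower {k} N (const N) (const B) (sum-const k B))
      N!≡ : N ! ≡ binomial * (f * g)
      N!≡ = sym (trans (cong (λ z → binomial * (f * z !)) (sym (ℕ.m+n∸m≡n B (k-1 * B)))) (nCk*k!*[n∸k]! {N} {B} (ℕ.m≤m+n B _)))
      N!^k : (N !) ℕ.^ k ≡ binomial ℕ.^ k * (f ℕ.^ k * g ℕ.^ k)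
      N!^k = trans (cong (ℕ._^ k) N!≡) (trans ([m*n]^k k binomial (f * g)) (cong (binomial ℕ.^ k *_) ([m*n]^k k f g)))
      g^k : g ℕ.^ k ≤ f ℕ.^ (k-1 * k) * k-1 ℕ.^ (k-1 * N)
      g^k = begin
        g ℕ.^ k                                                ≤⟨ ℕ.^-monoˡ-≤ k ([a*n]!≤n!^a*a^[a*n] k-1 B) ⟩
        (f ℕ.^ k-1 * k-1 ℕ.^ (k-1 * B)) ℕ.^ k                  ≡⟨ [m*n]^k k (f ℕ.^ k-1) (k-1 ℕ.^ (k-1 * B)) ⟩
        (f ℕ.^ k-1) ℕ.^ k * (k-1 ℕ.^ (k-1 * B)) ℕ.^ k          ≡⟨ cong₂ _*_ (ℕ.^-*-assoc f k-1 k) (ℕ.^-*-assoc k-1 (k-1 * B) k) ⟩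
        f ℕ.^ (k-1 * k) * k-1 ℕ.^ (k-1 * B * k)                ≡⟨ cong (λ z → f ℕ.^ (k-1 * k) * k-1 ℕ.^ z) (trans (ℕ.*-assoc k-1 B k) (cong (k-1 *_) (ℕ.*-comm B k))) ⟩
        f ℕ.^ (k-1 * k) * k-1 ℕ.^ (k-1 * N)                    ∎
      f-powers : f ℕ.^ k * (f ℕ.^ k * f ℕ.^ (k-1 * k)) ≡ f ℕ.^ (k * suc k)
      f-powers = trans (cong (f ℕ.^ k *_) (sym (ℕ.^-distribˡ-+-* f k (k-1 * k))))
        (trans (sym (ℕ.^-distribˡ-+-* f k (k * k))) (cong (f ℕ.^_) (sym (ℕ.*-suc k k))))
      regroup₁ : ∀ p q r s t → p * (q * (r * s)) * t ≡ p * q * (r * s * t)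
      regroup₁ = solve-∀
      regroup₂ : ∀ p q r s t → p * q * (q * (r * s) * t) ≡ p * s * t * (q * (q * r))
      regroup₂ = solve-∀

-- Lists as finite sets

module _ where
  open import Data.Nat using (_+_; _*_; _≤_; _<_; z≤n; s≤s)
  open Algebra.Properties.Semiring.Sum ℕ.+-*-semiring using (sum; sum-cong-≗)

  module _ {A : Set} where

    lookup-injective : {xs : List A} → Unique xs → ∀ i j → lookup xs i ≡ lookup xs j → i ≡ j
    lookup-injective (x∉ ∷ xs!) zero    zero    eq = refl
    lookup-injective (x∉ ∷ xs!) zero    (suc j) eq = contradiction eq (All.lookup x∉ (∈-lookup j))
    lookup-injective (x∉ ∷ xs!) (suc i) zero    eq = contradiction (sym eq) (All.lookup x∉ (∈-lookup i))
    lookup-injective (x∉ ∷ xs!) (suc i) (suc j) eq = cong suc (lookup-injective xs! i j eq)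

    -- Sending an index of `xs` to an index of the same element in `ys` is injective. The
    -- inequalities between counts of words are obtained from this.
    length-mono-⊆ : {xs ys : List A} → Unique xs → xs ⊆ ys → length xs ≤ length ys
    length-mono-⊆ {xs} {ys} xs! xs⊆ys = Fin.injective⇒≤ {f = position} λ {i} {j} eq →
      lookup-injective xs! i j
        (trans (lookup-position i) (trans (cong (lookup ys) eq) (sym (lookup-position j))))
      where
      position : Fin (length xs) → Fin (length ys)
      position i = Any.index (xs⊆ys (∈-lookup i))
      lookup-position : ∀ i → lookup xs i ≡ lookup ys (position i)
      lookup-position i = lookup-index (xs⊆ys (∈-lookup i))

    AllPairs-lookup : ∀ {R : A → A → Set} {xs} → AllPairs R xs →
                      ∀ i j → i Fin.< j → R (lookup xs i) (lookup xs j)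
    AllPairs-lookup (px ∷ pxs) zero    (suc j) i<j       = All.lookup px (∈-lookup j)
    AllPairs-lookup (px ∷ pxs) (suc i) (suc j) (s≤s i<j) = AllPairs-lookup pxs i j i<j

    length-concat-tabulate : ∀ {n} (f : Fin n → List A) → length (concat (tabulate f)) ≡ sum (length ∘ f)
    length-concat-tabulate {zero}  f = refl
    length-concat-tabulate {suc n} f =
      trans (length-++ (f zero)) (cong (length (f zero) +_) (length-concat-tabulate (f ∘ suc)))

    length-concat-applyDownFrom : ∀ (f : ℕ → List A) n → length (concat (applyDownFrom f n)) ≡ ∑< n (length ∘ f)
    length-concat-applyDownFrom f zero    = refl
    length-concat-applyDownFrom f (suc n) =
      trans (length-++ (f n)) (cong (length (f n) +_) (length-concat-applyDownFrom f n))

    ++-injective : ∀ (ws xs : List A) {ys zs} → length ws ≡ length xs →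
                   ws ++ ys ≡ xs ++ zs → ws ≡ xs × ys ≡ zs
    ++-injective []       []       _  eq = refl , eq
    ++-injective (w ∷ ws) (x ∷ xs) le eq =
      let w≡x , eq′ = ∷-injective eq
          ws≡xs , ys≡zs = ++-injective ws xs (ℕ.suc-injective le) eq′
      in cong₂ _∷_ w≡x ws≡xs , ys≡zs

    tabulate-injective : ∀ {n} {f g : Fin n → A} → tabulate f ≡ tabulate g → ∀ i → f i ≡ g i
    tabulate-injective eq zero    = ∷-injectiveˡ eq
    tabulate-injective eq (suc i) = tabulate-injective (∷-injectiveʳ eq) i

    -- Injectivity is asked only on members of the list, because `uncolour` is injective on block
    -- words but not on arbitrary coloured words.
    Unique-map⁺ : ∀ {B : Set} {f : A → B} {xs} →
                  (∀ {x y} → x ∈ xs → y ∈ xs → f x ≡ f y → x ≡ y) → Unique xs → Unique (map f xs)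
    Unique-map⁺ {xs = []}     inj []          = []
    Unique-map⁺ {xs = x ∷ xs} inj (x∉ ∷ xs!) =
      All.map⁺ (All.tabulate λ y∈ eq → All.lookup x∉ y∈ (inj (here refl) (there y∈) eq))
      ∷ Unique-map⁺ (λ x∈ y∈ → inj (there x∈) (there y∈)) xs!

  length-cartesianProduct : ∀ {A B : Set} (xs : List A) (ys : List B) →
                            length (cartesianProduct xs ys) ≡ length xs * length ys
  length-cartesianProduct []       ys = refl
  length-cartesianProduct (x ∷ xs) ys = trans (length-++ (map (x ,_) ys))
    (cong₂ _+_ (length-map (x ,_) ys) (length-cartesianProduct xs ys))

  ∑<-cong : ∀ n {f g : ℕ → ℕ} → (∀ i → f i ≡ g i) → ∑< n f ≡ ∑< n g
  ∑<-cong zero    f≗g = refl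
  ∑<-cong (suc n) f≗g = cong₂ _+_ (f≗g n) (∑<-cong n f≗g)

  -- Coloured words

  ColouredWord : ℕ → Set
  ColouredWord k = List (Fin k × ℕ)

  Below : ∀ {k} → (Fin k → ℕ) → Fin k × ℕ → Set
  Below m (c , v) = v < m c

  -- The left argument is the earlier letter, so `AllPairs _↘_ z` makes every colour class of `z`
  -- strictly decreasing.
  _↘_ : ∀ {k} → Fin k × ℕ → Fin k × ℕ → Set
  (c , v) ↘ (d , u) = c ≡ d → u < v

  -- The recursion runs parallel to that of `count`, which therefore gives the length of the list.
  colouredWords : ∀ {k} → ℕ → (Fin k → ℕ) → List (ColouredWord k)
  startingWith : ∀ {k} → ℕ → (Fin k → ℕ) → Fin k → List (ColouredWord k)

  colouredWords zero    m = [ [] ]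
  colouredWords (suc n) m = concat (tabulate (startingWith n m))

  startingWith n m c = concat (applyDownFrom (λ v → map ((c , v) ∷_) (colouredWords n (m [ c ≔ v ]))) (m c))

  length-colouredWords : ∀ {k} n (m : Fin k → ℕ) → length (colouredWords n m) ≡ count n m
  length-colouredWords zero    m = refl
  length-colouredWords (suc n) m = trans (length-concat-tabulate (startingWith n m)) (sum-cong-≗ λ c →
    trans (length-concat-applyDownFrom (λ v → map ((c , v) ∷_) (colouredWords n (m [ c ≔ v ]))) (m c)) (∑<-cong (m c) λ v →
      trans (length-map ((c , v) ∷_) (colouredWords n (m [ c ≔ v ]))) (length-colouredWords n (m [ c ≔ v ]))))

  ∈-startingWith⁻ : ∀ {k} n (m : Fin k → ℕ) c {z} → z ∈ startingWith n m c →
    ∃₂ λ v z′ → v < m c × z′ ∈ colouredWords n (m [ c ≔ v ]) × z ≡ (c , v) ∷ z′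
  ∈-startingWith⁻ n m c z∈ with ∈-concat⁻′ _ z∈
  ... | _ , z∈′ , ∈down with ∈-applyDownFrom⁻ (λ v → map ((c , v) ∷_) (colouredWords n (m [ c ≔ v ]))) ∈down
  ... | v , v<mc , refl with ∈-map⁻ ((c , v) ∷_) z∈′
  ... | z′ , z′∈ , z≡ = v , z′ , v<mc , z′∈ , z≡

  ∈-colouredWords⁺ : ∀ {k} {m : Fin k → ℕ} {z} → AllPairs _↘_ z → All (Below m) z →
                     z ∈ colouredWords (length z) m
  ∈-colouredWords⁺ {z = []} _ _ = here refl
  ∈-colouredWords⁺ {m = m} {z = (c , v) ∷ z} (v↘ ∷ z↘) (v<m ∷ z<m) =
    ∈-concat⁺′ (∈-concat⁺′ (∈-map⁺ ((c , v) ∷_) (∈-colouredWords⁺ z↘ (All.zipWith (λ (l , b) → below l b) (v↘ , z<m))))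
                           (∈-applyDownFrom⁺ (λ v → map ((c , v) ∷_) (colouredWords (length z) (m [ c ≔ v ]))) v<m))
               (∈-tabulate⁺ c)
    where
    below : ∀ {l} → (c , v) ↘ l → Below m l → Below (m [ c ≔ v ]) l
    below {d , u} v↘u u<m with c Fin.≟ d
    ... | yes refl = subst (u <_) (sym (updateAt-updates c m)) (v↘u refl)
    ... | no c≢d   = subst (u <_) (sym (updateAt-minimal d c m (c≢d ∘ sym))) u<m

  ∈-colouredWords⁻ : ∀ {k} n (m : Fin k → ℕ) {z} → z ∈ colouredWords n m →
                     length z ≡ n × AllPairs _↘_ z × All (Below m) z
  ∈-colouredWords⁻ zero    m (here refl) = refl , [] , []
  ∈-colouredWords⁻ (suc n) m z∈ with ∈-concat⁻′ (tabulate (startingWith n m)) z∈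
  ... | _ , z∈′ , ∈tab with ∈-tabulate⁻ ∈tab
  ... | c , refl with ∈-startingWith⁻ n m c z∈′
  ... | v , z′ , v<mc , z′∈ , refl with ∈-colouredWords⁻ n (m [ c ≔ v ]) z′∈
  ... | len , z↘ , z< = cong suc len , All.map below-v z< ∷ z↘ , v<mc ∷ All.map below-m z<
    where
    below-v : ∀ {l} → Below (m [ c ≔ v ]) l → (c , v) ↘ l
    below-v {d , u} u<v refl = subst (u <_) (updateAt-updates c m) u<v
    below-m : ∀ {l} → Below (m [ c ≔ v ]) l → Below m l
    below-m {d , u} u< with c Fin.≟ d
    ... | yes refl = ℕ.<-trans (below-v u< refl) v<mc
    ... | no c≢d   = subst (u <_) (updateAt-minimal d c m (c≢d ∘ sym)) u<

  colouredWords-unique : ∀ {k} n (m : Fin k → ℕ) → Unique (colouredWords n m)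
  colouredWords-unique zero    m = [] ∷ []
  colouredWords-unique (suc n) m = Unique.concat⁺
    (All.tabulate⁺ λ c → Unique.concat⁺
      (All.applyDownFrom⁺₂ _ (m c) λ v → Unique.map⁺ ∷-injectiveʳ (colouredWords-unique n (m [ c ≔ v ])))
      (AllPairs.applyDownFrom⁺₁ _ (m c) λ j<i _ (∈ᵢ , ∈ⱼ) →
        case ∈-map⁻ _ ∈ᵢ , ∈-map⁻ _ ∈ⱼ of λ where
          ((_ , _ , refl) , (_ , _ , eq)) → ℕ.<-irrefl (sym (cong proj₂ (∷-injectiveˡ eq))) j<i))
    (AllPairs.tabulate⁺ λ {c} {d} c≢d (∈c , ∈d) →
      case ∈-startingWith⁻ n m c ∈c , ∈-startingWith⁻ n m d ∈d of λ where
        ((_ , _ , _ , _ , refl) , (_ , _ , _ , _ , eq)) → c≢d (cong proj₁ (∷-injectiveˡ eq)))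

  -- Avoiding words as lists of letters

  letters : ∀ {m n} → Word m n → List ℕ
  letters w = tabulate (toℕ ∘ w)

  Avoiding : ∀ {m n} → ℕ → Word m n → Set
  Avoiding k w = ¬ HasWeaklyIncreasingSubsequence (suc k) w

  -- Passing to lists of numbers turns pointwise equality of words into propositional equality, in
  -- which `Unique` and `_⊆_` are expressed.
  avoidingWords : ℕ → ℕ → List (List ℕ)
  avoidingWords n k = map letters (filter (λ w → ¬? (hasWeaklyIncreasingSubsequence? (suc k) w)) (allWords n n))

  length-avoidingWords : ∀ n k → length (avoidingWords n k) ≡ w̄ n k
  length-avoidingWords n k = length-map letters (filter (λ w → ¬? (hasWeaklyIncreasingSubsequence? (suc k) w)) (allWords n n))

  funToFin-cong : ∀ {m n} {f g : Fin m → Fin n} → (∀ i → f i ≡ g i) → funToFin f ≡ funToFin g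
  funToFin-cong {zero}  f≗g = refl
  funToFin-cong {suc m} f≗g = cong₂ Fin.combine (f≗g zero) (funToFin-cong (f≗g ∘ suc))

  avoidingWords-unique : ∀ n k → Unique (avoidingWords n k)
  avoidingWords-unique n k = AllPairs.map⁺ (AllPairs.filter⁺ _ (AllPairs.map⁺
    (AllPairs.map (λ i≢j eq → i≢j (injective eq)) (Unique.allFin⁺ (n ℕ.^ n)))))
    where
    injective : ∀ {i j : Fin (n ℕ.^ n)} → letters (finToFun {n} {n} i) ≡ letters (finToFun {n} {n} j) → i ≡ j
    injective {i} {j} eq = begin
      i                                ≡⟨ Fin.funToFin-finToFin {n} {n} i ⟨
      funToFin (finToFun {n} {n} i)    ≡⟨ funToFin-cong (λ a → Fin.toℕ-injective (tabulate-injective eq a)) ⟩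
      funToFin (finToFun {n} {n} j)    ≡⟨ Fin.funToFin-finToFin {n} {n} j ⟩
      j                                ∎
      where open ≡-Reasoning

  ∈-avoidingWords⁺ : ∀ {n k} (w : Word n n) → Avoiding k w → letters w ∈ avoidingWords n k
  ∈-avoidingWords⁺ {n} {k} w av = subst (_∈ avoidingWords n k)
    (tabulate-cong (λ i → cong toℕ (Fin.finToFun-funToFin w i)))
    (∈-map⁺ letters (∈-filter⁺ _ (∈-map⁺ finToFun (∈-allFin (funToFin w)))
      λ (i , inc , winc) → av (i , inc , λ a b a≤b →
        subst₂ Fin._≤_ (Fin.finToFun-funToFin w (i a)) (Fin.finToFun-funToFin w (i b)) (winc a b a≤b))))

  ∈-avoidingWords⁻ : ∀ {n k xs} → xs ∈ avoidingWords n k → ∃[ w ] (Avoiding {n} {n} k w × xs ≡ letters w)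
  ∈-avoidingWords⁻ {n} xs∈ with ∈-map⁻ letters xs∈
  ... | w , w∈ , xs≡ = w , proj₂ (∈-filter⁻ _ {xs = allWords n n} w∈) , xs≡

  -- Every avoiding word can be coloured

  -- `c` is one more than the maximum of `f` on `P`, or 0 if `P` is empty. With `P` the later
  -- letters that can follow the first letter of a word, this is the colour of that first letter.
  bounded-max : ∀ {n} {P : Fin n → Set} → (∀ i → Dec (P i)) → (f : Fin n → ℕ) →
    ∃[ c ] ((∀ i → P i → f i < c) × (c ≡ 0 ⊎ ∃[ i ] (P i × c ≡ suc (f i))))
  bounded-max {zero}  P? f = 0 , (λ ()) , inj₁ refl
  bounded-max {suc n} P? f with bounded-max (P? ∘ suc) (f ∘ suc) | P? zero
  ... | c , f<c , at | no ¬p = c , (λ { zero p → contradiction p ¬p ; (suc i) → f<c i })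
                             , [ inj₁ , (λ (i , q) → inj₂ (suc i , q)) ]′ at
  ... | c , f<c , at | yes p with c ℕ.≤? f zero
  ...   | yes c≤f = suc (f zero) , (λ { zero _ → ℕ.≤-refl ; (suc i) q → ℕ.<-≤-trans (f<c i q) (ℕ.m≤n⇒m≤1+n c≤f) })
                  , inj₂ (zero , p , refl)
  ...   | no c≰f  = c , (λ { zero _ → ℕ.≰⇒> c≰f ; (suc i) → f<c i })
                  , [ inj₁ , (λ (i , q) → inj₂ (suc i , q)) ]′ at

  ChainFrom : ∀ {m n} → Word m n → Fin n → ℕ → Set
  ChainFrom {n = n} w p c =
    Σ[ i ∈ (Fin (suc c) → Fin n) ] (i zero ≡ p × StrictlyIncreasing i × WeaklyIncreasing (w ∘ i))

  module _ {m n} (w : Word m (suc n)) where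

    chain-suc : ∀ {p c} → ChainFrom (w ∘ suc) p c → ChainFrom w (suc p) c
    chain-suc (i , i0 , inc , winc) = suc ∘ i , cong suc i0 , (λ a b a<b → s≤s (inc a b a<b)) , winc

    chain-singleton : ChainFrom w zero 0
    chain-singleton = const zero , refl , (λ { zero zero () }) , (λ { zero zero _ → ℕ.≤-refl })

    chain-cons : ∀ {p c} → w zero Fin.≤ w (suc p) → ChainFrom (w ∘ suc) p c → ChainFrom w zero (suc c)
    chain-cons {p} {c} w₀≤ (i , i0 , inc , winc) = j , refl , j-inc , j-winc
      where
      j : Fin (suc (suc c)) → Fin (suc n)
      j zero    = zero
      j (suc a) = suc (i a)
      j-inc : StrictlyIncreasing j
      j-inc zero    (suc b) _         = s≤s z≤n
      j-inc (suc a) (suc b) (s≤s a<b) = s≤s (inc a b a<b)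
      j-winc : WeaklyIncreasing (w ∘ j)
      j-winc zero    zero    _         = ℕ.≤-refl
      j-winc zero    (suc b) _         = ℕ.≤-trans w₀≤ (subst (λ q → w (suc q) Fin.≤ w (suc (i b))) i0 (winc zero b z≤n))
      j-winc (suc a) (suc b) (s≤s a≤b) = winc a b a≤b

  -- The colour of a position is one less than the length of the longest weakly increasing subsequence starting there.
  chain-colouring : ∀ {m n} (w : Word m n) → Σ[ colour ∈ (Fin n → ℕ) ]
    ((∀ i j → i Fin.< j → colour i ≡ colour j → w j Fin.< w i) × (∀ i → ChainFrom w i (colour i)))
  chain-colouring {n = zero}  w = (λ ()) , (λ ()) , (λ ())
  chain-colouring {n = suc n} w with chain-colouring (w ∘ suc)
  ... | colour , decr , chain with bounded-max (λ j → w zero Fin.≤? w (suc j)) colour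
  ... | c , colour<c , at = colour′ , decr′ , chain′
    where
    colour′ : Fin (suc n) → ℕ
    colour′ zero    = c
    colour′ (suc i) = colour i
    decr′ : ∀ i j → i Fin.< j → colour′ i ≡ colour′ j → w j Fin.< w i
    -- A later letter that is at least `w zero` has a colour below `c`, so an equal colour forces a
    -- descent.
    decr′ zero    (suc j) _         eq = ℕ.≰⇒> λ w₀≤ → ℕ.<-irrefl (sym eq) (colour<c j w₀≤)
    decr′ (suc i) (suc j) (s≤s i<j) eq = decr i j i<j eq
    chain′ : ∀ i → ChainFrom w i (colour′ i)
    chain′ zero    = [ (λ c≡0 → subst (ChainFrom w zero) (sym c≡0) (chain-singleton w))
                     , (λ (i , w₀≤ , c≡) → subst (ChainFrom w zero) (sym c≡) (chain-cons w w₀≤ (chain i))) ]′ at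
    chain′ (suc i) = chain-suc w (chain i)

  chain-shorten : ∀ {m n} (w : Word m n) {p c} l → l ≤ suc c → ChainFrom w p c → HasWeaklyIncreasingSubsequence l w
  chain-shorten w l l≤ (i , _ , inc , winc) = (λ a → i (Fin.inject≤ a l≤))
    , (λ a b a<b → inc _ _ (subst₂ _<_ (sym (Fin.toℕ-inject≤ a l≤)) (sym (Fin.toℕ-inject≤ b l≤)) a<b))
    , (λ a b a≤b → winc _ _ (subst₂ _≤_ (sym (Fin.toℕ-inject≤ a l≤)) (sym (Fin.toℕ-inject≤ b l≤)) a≤b))

  uncolour : ∀ {k} → ColouredWord k → List ℕ
  uncolour = map proj₂

  avoidingWords⊆uncoloured : ∀ n k → avoidingWords n k ⊆ map uncolour (colouredWords {k} n (const n))
  avoidingWords⊆uncoloured n k xs∈ with ∈-avoidingWords⁻ {n} {k} xs∈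
  ... | w , av , refl with chain-colouring w
  ... | colour , decr , chain = subst (_∈ map uncolour (colouredWords {k} n (const n))) (map-tabulate letter proj₂)
      (∈-map⁺ uncolour (subst (λ l → z ∈ colouredWords l (const n)) (length-tabulate letter)
        (∈-colouredWords⁺ (AllPairs.tabulate⁺-< λ {i} {j} i<j eq → decr i j i<j (Fin.fromℕ<-injective _ _ _ _ eq))
                          (All.tabulate⁺ (λ i → Fin.toℕ<n (w i))))))
    where
    colour< : ∀ i → colour i < k
    -- Colours count from 0, so a colour of at least `k` comes with a chain of at least `suc k`
    -- letters.
    colour< i = ℕ.≰⇒> λ k≤ → av (chain-shorten w (suc k) (s≤s k≤) (chain i))
    letter : Fin n → Fin k × ℕ
    letter i = fromℕ< (colour< i) , toℕ (w i)
    z = tabulate letter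

  w̄≤count : ∀ n k → w̄ n k ≤ count {k} n (const n)
  w̄≤count n k = subst₂ _≤_ (length-avoidingWords n k)
    (trans (length-map uncolour (colouredWords {k} n (const n))) (length-colouredWords {k} n (const n)))
    (length-mono-⊆ (avoidingWords-unique n k) (avoidingWords⊆uncoloured n k))

  -- Gluing blocks of coloured words

  -- Among `suc k` positions two share a colour by the pigeonhole principle, and between these the
  -- letters strictly decrease.
  uncolour-∈-avoidingWords : ∀ {k} (z : ColouredWord k) → AllPairs _↘_ z →
    All (Below (const (length z))) z → uncolour z ∈ avoidingWords (length z) k
  uncolour-∈-avoidingWords {k} z z↘ z< = subst (_∈ avoidingWords (length z) k) letters-w (∈-avoidingWords⁺ w av)
    where
    w : Word (length z) (length z)
    w i = fromℕ< (All.lookup z< (∈-lookup i))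
    toℕ-w : ∀ i → toℕ (w i) ≡ proj₂ (lookup z i)
    toℕ-w i = Fin.toℕ-fromℕ< _
    letters-w : letters w ≡ uncolour z
    letters-w = trans (tabulate-cong toℕ-w) (trans (sym (map-tabulate (lookup z) proj₂)) (cong uncolour (tabulate-lookup z)))
    av : Avoiding k w
    av (i , inc , winc) with Fin.pigeonhole (ℕ.n<1+n k) (λ a → proj₁ (lookup z (i a)))
    ... | a , b , a<b , same = ℕ.≤⇒≯ (subst₂ _≤_ (toℕ-w (i a)) (toℕ-w (i b)) (winc a b (ℕ.<⇒≤ a<b)))
                                     (AllPairs-lookup z↘ (i a) (i b) (inc a b a<b) same)

  -- Colour by colour, so that letters of different colours need not be compared.
  runs : ∀ {k} → (Fin k → ℕ) → ColouredWord k
  runs h = concat (tabulate λ c → applyDownFrom (c ,_) (h c))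

  length-runs : ∀ {k} (h : Fin k → ℕ) → length (runs h) ≡ sum h
  length-runs h = trans (length-concat-tabulate (λ c → applyDownFrom (c ,_) (h c)))
    (sum-cong-≗ (λ c → length-applyDownFrom (c ,_) (h c)))

  runs-↘ : ∀ {k} (h : Fin k → ℕ) → AllPairs _↘_ (runs h)
  runs-↘ h = AllPairs.concat⁺
    (All.tabulate⁺ λ c → AllPairs.applyDownFrom⁺₁ _ (h c) λ j<i _ _ → j<i)
    (AllPairs.tabulate⁺ λ {c} {d} c≢d →
      All.applyDownFrom⁺₂ _ (h c) λ _ → All.applyDownFrom⁺₂ _ (h d) λ _ c≡d → contradiction c≡d c≢d)

  runs-Below : ∀ {k} (h : Fin k → ℕ) → All (Below h) (runs h)
  runs-Below h = All.concat⁺ (All.tabulate⁺ λ c → All.applyDownFrom⁺₁ _ (h c) id)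

  -- Remainder and quotient modulo `N` recover the two digits; `u < N` makes `N` positive.
  digits-unique : ∀ {N u v} a b → u < N → v < N → u + a * N ≡ v + b * N → u ≡ v × a ≡ b
  digits-unique {N@(suc _)} {u} {v} a b u<N v<N eq = u≡v , ℕ.*-cancelʳ-≡ a b N (ℕ.+-cancelˡ-≡ v _ _ (subst (λ x → x + a * N ≡ v + b * N) u≡v eq))
    where
    open ≡-Reasoning
    u≡v : u ≡ v
    u≡v = begin
      u                ≡⟨ m<n⇒m%n≡m u<N ⟨
      u % N            ≡⟨ [m+kn]%n≡m%n u a N ⟨
      (u + a * N) % N  ≡⟨ cong (_% N) eq ⟩
      (v + b * N) % N  ≡⟨ [m+kn]%n≡m%n v b N ⟩
      v % N            ≡⟨ m<n⇒m%n≡m v<N ⟩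
      v                ∎

  module _ {k} (N base : ℕ) (pad : ColouredWord k) where

    -- In the block followed by t others, colour c uses the (t + c)-th interval of N values,
    -- so that the colour of a letter can be read off from its position and its value.
    shift : ℕ → Fin k × ℕ → Fin k × ℕ
    shift t (c , v) = c , base + (v + (t + toℕ c) * N)

    glue : ℕ → ColouredWord k × ColouredWord k → ColouredWord k
    glue t (z , r) = map (shift t) z ++ r

    -- The block put in front is the one followed by `t` others and takes higher values than they do
    -- in each colour; `pad` ends every word.
    blockWords : ℕ → List (ColouredWord k)
    blockWords zero    = [ pad ]
    blockWords (suc t) = map (glue t) (cartesianProduct (colouredWords N (const N)) (blockWords t))

    length-blockWords : ∀ t → length (blockWords t) ≡ count {k} N (const N) ℕ.^ t
    length-blockWords zero    = refl
    length-blockWords (suc t) = begin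
      length (blockWords (suc t))
        ≡⟨ length-map (glue t) (cartesianProduct (colouredWords N (const N)) (blockWords t)) ⟩
      length (cartesianProduct (colouredWords N (const N)) (blockWords t))
        ≡⟨ length-cartesianProduct (colouredWords {k} N (const N)) (blockWords t) ⟩
      length (colouredWords {k} N (const N)) * length (blockWords t)
        ≡⟨ cong₂ _*_ (length-colouredWords {k} N (const N)) (length-blockWords t) ⟩
      count {k} N (const N) * count {k} N (const N) ℕ.^ t ∎
      where open ≡-Reasoning

    ∈-blockWords⁻ : ∀ t {z} → z ∈ blockWords (suc t) →
      ∃₂ λ b r → b ∈ colouredWords N (const N) × r ∈ blockWords t × z ≡ glue t (b , r)
    ∈-blockWords⁻ t z∈ with ∈-map⁻ (glue t) z∈
    ... | (b , r) , br∈ , z≡ with ∈-cartesianProduct⁻ (colouredWords N (const N)) (blockWords t) br∈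
    ... | b∈ , r∈ = b , r , b∈ , r∈ , z≡

    -- The lower end of the interval that `shift t` assigns to colour `c`, hence a strict bound for
    -- the letters of that colour in everything after the block.
    interval : ℕ → Fin k → ℕ
    interval t c = base + (t + toℕ c) * N

    -- Inside a block the shift preserves descents within a colour; across its end they hold because
    -- the rest lies below `interval t`, where the values of the block begin.
    blockWords-valid : AllPairs _↘_ pad → All (Below (const base)) pad → ∀ t {z} → z ∈ blockWords t →
      length z ≡ t * N + length pad × AllPairs _↘_ z × All (Below (interval t)) z
    blockWords-valid pad↘ pad< zero (here refl) = refl , pad↘ , All.map (λ v< → ℕ.<-≤-trans v< (ℕ.m≤m+n base _)) pad<
    blockWords-valid pad↘ pad< (suc t) z∈ with ∈-blockWords⁻ t z∈
    ... | b , r , b∈ , r∈ , refl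
        with ∈-colouredWords⁻ N (const N) b∈ | blockWords-valid pad↘ pad< t r∈
    ... | lb , b↘ , b< | lr , r↘ , r< = len
        , AllPairs.++⁺ (AllPairs.map⁺ (AllPairs.map shift-↘ b↘)) r↘ (All.map⁺ (All.universal (λ l → All.map above r<) b))
        , All.++⁺ (All.map⁺ (All.map shift< b<)) (All.map (λ v< → ℕ.<-≤-trans v< (ℕ.+-monoʳ-≤ base (ℕ.m≤n+m _ N))) r<)
      where
      len : length (map (shift t) b ++ r) ≡ N + t * N + length pad
      len = begin
        length (map (shift t) b ++ r)          ≡⟨ length-++ (map (shift t) b) ⟩
        length (map (shift t) b) + length r    ≡⟨ cong₂ _+_ (trans (length-map (shift t) b) lb) lr ⟩
        N + (t * N + length pad)               ≡⟨ ℕ.+-assoc N (t * N) (length pad) ⟨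
        N + t * N + length pad                 ∎
        where open ≡-Reasoning
      shift-↘ : ∀ {l l′} → l ↘ l′ → shift t l ↘ shift t l′
      shift-↘ l↘l′ refl = ℕ.+-monoʳ-< base (ℕ.+-monoˡ-< _ (l↘l′ refl))
      above : ∀ {l l′} → Below (interval t) l′ → shift t l ↘ l′
      above {c , v} v< refl = ℕ.<-≤-trans v< (ℕ.+-monoʳ-≤ base (ℕ.m≤n+m _ v))
      shift< : ∀ {l} → Below (const N) l → Below (interval (suc t)) (shift t l)
      shift< v<N = ℕ.+-monoʳ-< base (ℕ.+-monoˡ-< _ v<N)

    -- The position of the block fixes `t`. The base `N` digits of a shifted value then give the
    -- letter `v` as remainder and the colour through the quotient `t + toℕ c`.
    shift-injective : ∀ t {b b′ : ColouredWord k} → All (Below (const N)) b → All (Below (const N)) b′ →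
      map (proj₂ ∘ shift t) b ≡ map (proj₂ ∘ shift t) b′ → b ≡ b′
    shift-injective t {[]} {[]} _ _ _ = refl
    shift-injective t {(c , v) ∷ _} {(c′ , v′) ∷ _} (v< ∷ b<) (v′< ∷ b′<) eq
      with digits-unique (t + toℕ c) (t + toℕ c′) v< v′< (ℕ.+-cancelˡ-≡ base _ _ (∷-injectiveˡ eq))
    ... | v≡v′ , tc≡tc′ = cong₂ _∷_ (cong₂ _,_ (Fin.toℕ-injective (ℕ.+-cancelˡ-≡ t _ _ tc≡tc′)) v≡v′)
                                    (shift-injective t b< b′< (∷-injectiveʳ eq))

    uncolour-glue-injective : ∀ t {b b′ r r′} → b ∈ colouredWords N (const N) → b′ ∈ colouredWords N (const N) →
      uncolour (glue t (b , r)) ≡ uncolour (glue t (b′ , r′)) → b ≡ b′ × uncolour r ≡ uncolour r′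
    uncolour-glue-injective t {b} {b′} {r} {r′} b∈ b′∈ eq
      with ∈-colouredWords⁻ N (const N) b∈ | ∈-colouredWords⁻ N (const N) b′∈
    ... | lb , _ , b< | lb′ , _ , b′<
      with ++-injective (map (proj₂ ∘ shift t) b) (map (proj₂ ∘ shift t) b′)
             (trans (trans (length-map _ b) lb) (sym (trans (length-map _ b′) lb′)))
             (trans (sym (uncolour-glue b r)) (trans eq (uncolour-glue b′ r′)))
      where
      uncolour-glue : ∀ b r → uncolour (glue t (b , r)) ≡ map (proj₂ ∘ shift t) b ++ uncolour r
      uncolour-glue b r = trans (map-++ proj₂ (map (shift t) b) r) (cong (_++ uncolour r) (sym (map-∘ b)))
    ... | eq₁ , eq₂ = shift-injective t b< b′< eq₁ , eq₂

    -- All blocks have length `N`, so an uncoloured word splits into its blocks, each of which can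
    -- be decoded; the padding is the same in all words.
    uncolour-injective : ∀ t {z z′} → z ∈ blockWords t → z′ ∈ blockWords t → uncolour z ≡ uncolour z′ → z ≡ z′
    uncolour-injective zero (here refl) (here refl) _ = refl
    uncolour-injective (suc t) z∈ z′∈ eq with ∈-blockWords⁻ t z∈ | ∈-blockWords⁻ t z′∈
    ... | b , r , b∈ , r∈ , refl | b′ , r′ , b′∈ , r′∈ , refl with uncolour-glue-injective t b∈ b′∈ eq
    ... | b≡b′ , eq′ = cong₂ (λ b r → glue t (b , r)) b≡b′ (uncolour-injective t r∈ r′∈ eq′)

    blockWords-unique : ∀ t → Unique (blockWords t)
    blockWords-unique zero    = [] ∷ []
    blockWords-unique (suc t) = Unique-map⁺ glue-injective
      (Unique.cartesianProduct⁺ (colouredWords-unique N (const N)) (blockWords-unique t))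
      where
      glue-injective : ∀ {x y} → x ∈ cartesianProduct (colouredWords N (const N)) (blockWords t) →
        y ∈ cartesianProduct (colouredWords N (const N)) (blockWords t) → glue t x ≡ glue t y → x ≡ y
      glue-injective {b , r} {b′ , r′} x∈ y∈ eq
        with ∈-cartesianProduct⁻ (colouredWords N (const N)) (blockWords t) x∈
           | ∈-cartesianProduct⁻ (colouredWords N (const N)) (blockWords t) y∈
      ... | b∈ , r∈ | b′∈ , r′∈ with uncolour-glue-injective t b∈ b′∈ (cong uncolour eq)
      ... | b≡b′ , eq′ = cong₂ _,_ b≡b′ (uncolour-injective t r∈ r′∈ eq′)

    count^t≤w̄ : ∀ {n} t → AllPairs _↘_ pad → All (Below (const base)) pad →
      t * N + length pad ≡ n → (∀ c → interval t c ≤ n) → count {k} N (const N) ℕ.^ t ≤ w̄ n k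
    count^t≤w̄ {n} t pad↘ pad< len interval≤n = subst₂ _≤_
      (trans (length-map uncolour (blockWords t)) (length-blockWords t))
      (length-avoidingWords n k)
      (length-mono-⊆ (Unique-map⁺ (uncolour-injective t) (blockWords-unique t)) avoiding)
      where
      avoiding : map uncolour (blockWords t) ⊆ avoidingWords n k
      avoiding xs∈ with ∈-map⁻ uncolour xs∈
      ... | z , z∈ , refl with blockWords-valid pad↘ pad< t z∈
      ... | lz , z↘ , z< with trans lz len
      ... | refl = uncolour-∈-avoidingWords z z↘
        (All.map (λ {(c , _)} v< → ℕ.<-≤-trans v< (interval≤n c)) z<)

  -- A word must be as long as its alphabet is large. The blocks have `t * N` letters, but their
  -- values reach up to `base + (t + k-1) * N`. Padding with `k * N + s` letters, colour 0 taking
  -- the surplus `s`, allows `base = N + s` and makes both numbers `(t + k) * N + s`.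
  diagonal^t≤w̄ : ∀ k-1 N t s → let k = suc k-1 in
    diagonal k-1 N ℕ.^ t ≤ w̄ ((t + k) * N + s) k
  diagonal^t≤w̄ k-1 N t s = count^t≤w̄ N (N + s) (runs h) t (runs-↘ h)
    (All.map (λ {(c , _)} v< → ℕ.<-≤-trans v< (h≤N+s c)) (runs-Below h)) length≡ interval≤
    where
    h : Fin (suc k-1) → ℕ
    h zero    = N + s
    h (suc _) = N
    h≤N+s : ∀ c → h c ≤ N + s
    h≤N+s zero    = ℕ.≤-refl
    h≤N+s (suc _) = ℕ.m≤m+n N s
    length≡ : t * N + length (runs h) ≡ (t + suc k-1) * N + s
    length≡ = begin
      t * N + length (runs h)                ≡⟨ cong (t * N +_) (length-runs h) ⟩
      t * N + (N + s + sum {k-1} (const N))  ≡⟨ cong (λ x → t * N + (N + s + x)) (sum-const k-1 N) ⟩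
      t * N + (N + s + k-1 * N)              ≡⟨ arith t N s k-1 ⟩
      (t + suc k-1) * N + s                  ∎
      where
      open ≡-Reasoning
      arith : ∀ t N s k → t * N + (N + s + k * N) ≡ (t + suc k) * N + s
      arith = solve-∀
    interval≤ : ∀ c → interval N (N + s) (runs h) t c ≤ (t + suc k-1) * N + s
    interval≤ c = begin
      N + s + (t + toℕ c) * N   ≤⟨ ℕ.+-monoʳ-≤ (N + s) (ℕ.*-monoˡ-≤ N (ℕ.+-monoʳ-≤ t (ℕ.≤-pred (Fin.toℕ<n c)))) ⟩
      N + s + (t + k-1) * N     ≡⟨ arith t N s k-1 ⟩
      (t + suc k-1) * N + s     ∎
      where
      open ℕ.≤-Reasoning
      arith : ∀ t N s k → N + s + (t + k) * N ≡ (t + suc k) * N + s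
      arith = solve-∀

-- Standardization

module _ {m n} (w : Word m n) where

  Precedes-irrefl : ∀ p → ¬ Precedes w p p
  Precedes-irrefl p (inj₁ w<w)       = ℕ.<-irrefl refl w<w
  Precedes-irrefl p (inj₂ (_ , p<p)) = ℕ.<-irrefl refl p<p

  Precedes-trans : ∀ {p q r} → Precedes w p q → Precedes w q r → Precedes w p r
  Precedes-trans {p} {q} {r} (inj₁ wp<wq)         (inj₁ wq<wr)         = inj₁ (ℕ.<-trans wp<wq wq<wr)
  Precedes-trans {p} {q} {r} (inj₁ wp<wq)         (inj₂ (wq≡wr , _))   = inj₁ (subst (w p Fin.<_) wq≡wr wp<wq)
  Precedes-trans {p} {q} {r} (inj₂ (wp≡wq , _))   (inj₁ wq<wr)         = inj₁ (subst (Fin._< w r) (sym wp≡wq) wq<wr)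
  Precedes-trans {p} {q} {r} (inj₂ (wp≡wq , p<q)) (inj₂ (wq≡wr , q<r)) = inj₂ (trans wp≡wq wq≡wr , ℕ.<-trans p<q q<r)

  -- The predecessors of `p`, together with `p` itself, are all predecessors of `q`.
  rank-mono-< : ∀ {p q} → Precedes w p q → rank w p ℕ.< rank w q
  rank-mono-< {p} {q} p≺q = length-mono-⊆ (All.tabulate p≢ ∷ Unique.filter⁺ _ (Unique.allFin⁺ n)) p∷↓p⊆↓q
    where
    ↓ : Fin n → List (Fin n)
    ↓ r = filter (λ j → precedes? w j r) (allFin n)
    p≢ : ∀ {j} → j ∈ ↓ p → p ≢ j
    p≢ j∈ refl = Precedes-irrefl p (proj₂ (∈-filter⁻ _ {xs = allFin n} j∈))
    p∷↓p⊆↓q : (p ∷ ↓ p) ⊆ ↓ q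
    p∷↓p⊆↓q (here refl) = ∈-filter⁺ _ (∈-allFin p) p≺q
    p∷↓p⊆↓q (there j∈)  = ∈-filter⁺ _ (∈-allFin _) (Precedes-trans (proj₂ (∈-filter⁻ _ {xs = allFin n} j∈)) p≺q)

  std-mono-< : ∀ {p q} → Precedes w p q → std w p Fin.< std w q
  std-mono-< p≺q = subst₂ ℕ._<_ (sym (Fin.toℕ-fromℕ< _)) (sym (Fin.toℕ-fromℕ< _)) (rank-mono-< p≺q)

  -- Equal letters are numbered from left to right, so a weak ascent becomes strict after
  -- standardization.
  ≤⇒std-< : ∀ {p q} → p Fin.< q → w p Fin.≤ w q → std w p Fin.< std w q
  ≤⇒std-< p<q wp≤wq with ℕ.m≤n⇒m<n∨m≡n wp≤wq
  ... | inj₁ wp<wq = std-mono-< (inj₁ wp<wq)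
  ... | inj₂ wp≡wq = std-mono-< (inj₂ (Fin.toℕ-injective wp≡wq , p<q))

  std-<⇒≤ : ∀ {p q} → std w p Fin.< std w q → w p Fin.≤ w q
  std-<⇒≤ sp<sq = ℕ.≮⇒≥ λ wq<wp → ℕ.<-asym sp<sq (std-mono-< (inj₁ wq<wp))

  -- The same choice of positions serves on both sides: along increasing positions, `w` is weakly
  -- increasing exactly when `std w` is strictly increasing. The strict increase also reflects the
  -- order, as `Contains` demands.
  avoids⇔std-avoids : ∀ l → (¬ HasWeaklyIncreasingSubsequence l w) ⇔ Avoids (std w) (identity l)
  avoids⇔std-avoids l = mk⇔
    (λ ¬wi (i , inc , iso) → ¬wi (i , inc , λ a b a≤b → weakly i iso a b (ℕ.m≤n⇒m<n∨m≡n a≤b)))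
    (λ av (i , inc , winc) → av (i , inc , λ a b → mk⇔ (increasing i inc winc a b) (reflects i inc winc a b)))
    where
    weakly : ∀ (i : Fin l → Fin n) → (∀ a b → a Fin.< b ⇔ std w (i a) Fin.< std w (i b)) →
             ∀ a b → a Fin.< b ⊎ toℕ a ≡ toℕ b → w (i a) Fin.≤ w (i b)
    weakly i iso a b (inj₁ a<b) = std-<⇒≤ (Equivalence.to (iso a b) a<b)
    weakly i iso a b (inj₂ a≡b) rewrite Fin.toℕ-injective a≡b = ℕ.≤-refl
    module _ (i : Fin l → Fin n) (inc : StrictlyIncreasing i) (winc : WeaklyIncreasing (w ∘ i)) where
      increasing : ∀ a b → a Fin.< b → std w (i a) Fin.< std w (i b)
      increasing a b a<b = ≤⇒std-< (inc a b a<b) (winc a b (ℕ.<⇒≤ a<b))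
      reflects : ∀ a b → std w (i a) Fin.< std w (i b) → a Fin.< b
      reflects a b s< with Fin.<-cmp a b
      ... | tri< a<b _ _  = a<b
      ... | tri≈ _ refl _ = contradiction s< (ℕ.<-irrefl refl)
      ... | tri> _ _ b<a  = contradiction s< (ℕ.<-asym (increasing b a b<a))

-- Growth rates

module _ where
  open import Data.Integer using (+_)
  open import Data.Rational using (ℚ; 0ℚ; 1ℚ; _+_; _*_; _-_; _≤_; _<_; _/_; -_; 1/_; toℚᵘ; Positive; positive; nonNegative; ↥_; mkℚ; _<?_)
  open import Data.Rational.Properties
  open CommutativeRing +-*-commutativeRing using (commutativeSemiring; semiring)
  open Algebra.Properties.CommutativeSemiring.Exp commutativeSemiring using (^-distrib-*)
  open Algebra.Properties.Semiring.Exp semiring using (^-homo-*; ^-assocʳ)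

  ι : ℕ → ℚ
  ι n = + n / 1

  toℚᵘ-/ : ∀ i d .{{_ : NonZero d}} → toℚᵘ (i / d) ℚᵘ.≃ (i ℚᵘ./ d)
  toℚᵘ-/ i (suc d-1) = toℚᵘ-fromℚᵘ (ℚᵘ.mkℚᵘ i d-1)

  ι-mono-≤ : ∀ {m n} → m ℕ.≤ n → ι m ≤ ι n
  ι-mono-≤ {m} {n} m≤n = toℚᵘ-cancel-≤ (ℚᵘ.≤-respˡ-≃ (ℚᵘ.≃-sym (toℚᵘ-/ (+ m) 1)) (ℚᵘ.≤-respʳ-≃ (ℚᵘ.≃-sym (toℚᵘ-/ (+ n) 1))
    (ℚᵘ.*≤* (ℤ.*-monoʳ-≤-nonNeg (+ 1) (ℤ.+≤+ m≤n)))))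

  ι-* : ∀ m n → ι (m ℕ.* n) ≡ ι m * ι n
  ι-* m n = toℚᵘ-injective (begin
    toℚᵘ (ι (m ℕ.* n))                 ≈⟨ toℚᵘ-/ (+ (m ℕ.* n)) 1 ⟩
    + (m ℕ.* n) ℚᵘ./ 1                 ≈⟨ ℚᵘ.*≡* (cong (ℤ._* (+ 1)) (ℤ.pos-* m n)) ⟩
    (+ m ℚᵘ./ 1) ℚᵘ.* (+ n ℚᵘ./ 1)     ≈⟨ ℚᵘ.*-cong (toℚᵘ-/ (+ m) 1) (toℚᵘ-/ (+ n) 1) ⟨
    toℚᵘ (ι m) ℚᵘ.* toℚᵘ (ι n)         ≈⟨ toℚᵘ-homo-* (ι m) (ι n) ⟨
    toℚᵘ (ι m * ι n)                   ∎)
    where open ℚᵘ.≃-Reasoning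

  ι-suc : ∀ n → ι (suc n) ≡ 1ℚ + ι n
  ι-suc n = toℚᵘ-injective (begin
    toℚᵘ (ι (suc n))                   ≈⟨ toℚᵘ-/ (+ suc n) 1 ⟩
    + suc n ℚᵘ./ 1                     ≈⟨ ℚᵘ.*≡* (cong (ℤ._* (+ 1)) (cong (ℤ._+_ (+ 1)) (sym (ℤ.*-identityʳ (+ n))))) ⟩
    (+ 1 ℚᵘ./ 1) ℚᵘ.+ (+ n ℚᵘ./ 1)     ≈⟨ ℚᵘ.+-cong (ℚᵘ.≃-refl {toℚᵘ 1ℚ}) (toℚᵘ-/ (+ n) 1) ⟨
    toℚᵘ 1ℚ ℚᵘ.+ toℚᵘ (ι n)            ≈⟨ toℚᵘ-homo-+ 1ℚ (ι n) ⟨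
    toℚᵘ (1ℚ + ι n)                    ∎)
    where open ℚᵘ.≃-Reasoning

  ι-^ : ∀ m n → ι (m ℕ.^ n) ≡ ι m ^ n
  ι-^ m zero    = refl
  ι-^ m (suc n) = trans (ι-* m (m ℕ.^ n)) (cong (ι m *_) (ι-^ m n))

  /*ι : ∀ m d .{{_ : NonZero d}} → (+ m / d) * ι d ≡ ι m
  /*ι m d@(suc _) = toℚᵘ-injective (begin
    toℚᵘ ((+ m / d) * ι d)             ≈⟨ toℚᵘ-homo-* (+ m / d) (ι d) ⟩
    toℚᵘ (+ m / d) ℚᵘ.* toℚᵘ (ι d)     ≈⟨ ℚᵘ.*-cong (toℚᵘ-/ (+ m) d) (toℚᵘ-/ (+ d) 1) ⟩
    (+ m ℚᵘ./ d) ℚᵘ.* (+ d ℚᵘ./ 1)     ≈⟨ ℚᵘ.*≡* (trans (ℤ.*-identityʳ _) (cong (λ x → + m ℤ.* + x) (sym (ℕ.*-identityʳ d)))) ⟩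
    + m ℚᵘ./ 1                         ≈⟨ toℚᵘ-/ (+ m) 1 ⟨
    toℚᵘ (ι m)                         ∎)
    where open ℚᵘ.≃-Reasoning

  ι-pos : ∀ n .{{_ : NonZero n}} → 0ℚ < ι n
  ι-pos n = <-≤-trans (positive⁻¹ 1ℚ) (ι-mono-≤ (ℕ.>-nonZero⁻¹ n))

  ≤ι∣↥∣ : ∀ p → p ≤ ι ℤ.∣ ↥ p ∣
  ≤ι∣↥∣ p = toℚᵘ-cancel-≤ (ℚᵘ.≤-respʳ-≃ (ℚᵘ.≃-sym (toℚᵘ-/ (+ ℤ.∣ ↥ p ∣) 1)) (bound p))
    where
    bound : ∀ p → toℚᵘ p ℚᵘ.≤ (+ ℤ.∣ ↥ p ∣ ℚᵘ./ 1)
    bound (mkℚ (+ n)        d-1 _) = ℚᵘ.*≤* (ℤ.*-monoˡ-≤-nonNeg (+ n) (ℤ.+≤+ (ℕ.s≤s ℕ.z≤n)))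
    bound (mkℚ (ℤ.-[1+ n ]) d-1 _) = ℚᵘ.*≤* ℤ.-≤+

  -- Exponential against polynomial growth

  archimedean : ∀ x y → 0ℚ < x → ∃[ n ] y ≤ ι n * x
  archimedean x y 0<x = ℤ.∣ ↥ c ∣ , (begin
    y                     ≡⟨ x*c/x x y ⟨
    x * c                 ≡⟨ *-comm x c ⟩
    c * x                 ≤⟨ *-monoʳ-≤-nonNeg x {{nonNegative (<⇒≤ 0<x)}} (≤ι∣↥∣ c) ⟩
    ι ℤ.∣ ↥ c ∣ * x       ∎)
    where
    open ≤-Reasoning
    instance
      x≢0 : ℚ.NonZero x
      x≢0 = pos⇒nonZero x {{positive 0<x}}
    c = 1/ x * y

  bernoulli : ∀ x n → 0ℚ ≤ x → 1ℚ + ι n * x ≤ (1ℚ + x) ^ n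
  bernoulli x zero    0≤x = ≤-reflexive (trans (cong (_+_ 1ℚ) (*-zeroˡ x)) (+-identityʳ 1ℚ))
  bernoulli x (suc n) 0≤x = begin
    1ℚ + ι (suc n) * x                     ≡⟨ cong (λ z → 1ℚ + z * x) (ι-suc n) ⟩
    1ℚ + (1ℚ + ι n) * x                    ≡⟨ expand₁ x (ι n) ⟩
    1ℚ + ι n * x + x                       ≤⟨ +-monoʳ-≤ (1ℚ + ι n * x) x≤ ⟩
    1ℚ + ι n * x + x * (1ℚ + ι n * x)      ≡⟨ expand₂ x (1ℚ + ι n * x) ⟩
    (1ℚ + x) * (1ℚ + ι n * x)              ≤⟨ *-monoˡ-≤-nonNeg (1ℚ + x) {{nonNegative 0≤1+x}} (bernoulli x n 0≤x) ⟩
    (1ℚ + x) * (1ℚ + x) ^ n                ∎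
    where
    open ≤-Reasoning
    expand₁ : ∀ x y → 1ℚ + (1ℚ + y) * x ≡ 1ℚ + y * x + x
    expand₁ x y = trans (cong (_+_ 1ℚ) (trans (*-distribʳ-+ x 1ℚ y) (trans (cong (_+ y * x) (*-identityˡ x)) (+-comm x (y * x)))))
                        (sym (+-assoc 1ℚ (y * x) x))
    expand₂ : ∀ x z → z + x * z ≡ (1ℚ + x) * z
    expand₂ x z = sym (trans (*-distribʳ-+ z 1ℚ x) (cong (_+ x * z) (*-identityˡ z)))
    0≤ιn*x : 0ℚ ≤ ι n * x
    0≤ιn*x = subst (_≤ ι n * x) (*-zeroʳ (ι n)) (*-monoˡ-≤-nonNeg (ι n) {{nonNegative (0≤fromℕ n)}} 0≤x)
    1≤ : 1ℚ ≤ 1ℚ + ι n * x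
    1≤ = subst (_≤ 1ℚ + ι n * x) (+-identityʳ 1ℚ) (+-monoʳ-≤ 1ℚ 0≤ιn*x)
    x≤ : x ≤ x * (1ℚ + ι n * x)
    x≤ = subst (_≤ x * (1ℚ + ι n * x)) (*-identityʳ x) (*-monoˡ-≤-nonNeg x {{nonNegative 0≤x}} 1≤)
    0≤1+x : 0ℚ ≤ 1ℚ + x
    0≤1+x = ≤-trans 0≤x (subst (_≤ 1ℚ + x) (+-identityˡ x) (+-monoˡ-≤ x (nonNegative⁻¹ 1ℚ)))

  1^n≡1 : ∀ n → 1ℚ ^ n ≡ 1ℚ
  1^n≡1 zero    = refl
  1^n≡1 (suc n) = trans (*-identityˡ (1ℚ ^ n)) (1^n≡1 n)

  1≤ρ^n : ∀ {ρ} n → 1ℚ ≤ ρ → 1ℚ ≤ ρ ^ n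
  1≤ρ^n {ρ} n 1≤ρ = subst (_≤ ρ ^ n) (1^n≡1 n) (^-mono-≤ n (nonNegative⁻¹ 1ℚ) 1≤ρ)

  ^-monoʳ-≤ : ∀ {ρ m n} → 1ℚ ≤ ρ → m ℕ.≤ n → ρ ^ m ≤ ρ ^ n
  ^-monoʳ-≤ {ρ} {m} {n} 1≤ρ m≤n = begin
    ρ ^ m                        ≡⟨ *-identityʳ (ρ ^ m) ⟨
    ρ ^ m * 1ℚ                   ≤⟨ *-monoˡ-≤-nonNeg (ρ ^ m) {{nonNegative (^-nonNeg m (≤-trans (nonNegative⁻¹ 1ℚ) 1≤ρ))}} (1≤ρ^n (n ℕ.∸ m) 1≤ρ) ⟩
    ρ ^ m * ρ ^ (n ℕ.∸ m)        ≡⟨ ^-homo-* ρ m (n ℕ.∸ m) ⟨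
    ρ ^ (m ℕ.+ (n ℕ.∸ m))        ≡⟨ cong (ρ ^_) (ℕ.m+[n∸m]≡n m≤n) ⟩
    ρ ^ n                        ∎
    where open ≤-Reasoning

  module _ {ρ} (1<ρ : 1ℚ < ρ) where
    private
      x = ρ - 1ℚ
      0<x : 0ℚ < x
      0<x = subst (_< x) (+-inverseʳ 1ℚ) (+-monoˡ-< (- 1ℚ) 1<ρ)
      1≤ρ = <⇒≤ 1<ρ
      0≤ρ = ≤-trans (nonNegative⁻¹ 1ℚ) 1≤ρ

    ι*[ρ-1]<ρ^ : ∀ n → ι n * x < ρ ^ n
    ι*[ρ-1]<ρ^ n = begin-strict
      ι n * x            ≡⟨ +-identityˡ (ι n * x) ⟨
      0ℚ + ι n * x       <⟨ +-monoˡ-< (ι n * x) (positive⁻¹ 1ℚ) ⟩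
      1ℚ + ι n * x       ≤⟨ bernoulli x n (<⇒≤ 0<x) ⟩
      (1ℚ + x) ^ n       ≡⟨ cong (_^ n) (trans (+-comm 1ℚ x) (cancel⁺ ρ 1ℚ)) ⟩
      ρ ^ n              ∎
      where open ≤-Reasoning

    ^-unbounded : ∀ y → ∃[ n ] y < ρ ^ n
    ^-unbounded y = let n , y≤ = archimedean x y 0<x in n , ≤-<-trans y≤ (ι*[ρ-1]<ρ^ n)

    -- ρ ^ (2 i) exceeds the square of i (ρ - 1), which outgrows every multiple of i.
    ^-beats-power : ∀ e → ∃[ i ] ∀ N → N ≡ e ℕ.* (2 ℕ.* suc i) → ι N ^ e ≤ ρ ^ N
    ^-beats-power e = i , λ N N≡ → subst (λ N → ι N ^ e ≤ ρ ^ N) (sym N≡) (begin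
      ι (e ℕ.* (2 ℕ.* j)) ^ e               ≤⟨ ^-mono-≤ e (0≤fromℕ (e ℕ.* (2 ℕ.* j))) base ⟩
      (ρ ^ (2 ℕ.* j)) ^ e                   ≡⟨ ^-assocʳ ρ (2 ℕ.* j) e ⟩
      ρ ^ (2 ℕ.* j ℕ.* e)                   ≡⟨ cong (ρ ^_) (ℕ.*-comm (2 ℕ.* j) e) ⟩
      ρ ^ (e ℕ.* (2 ℕ.* j))                 ∎)
      where
      open ≤-Reasoning
      0<x*x : 0ℚ < x * x
      0<x*x = positive⁻¹ (x * x) {{pos*pos⇒pos x {{positive 0<x}} x {{positive 0<x}}}}
      -- With `ι i * (x * x)` at least `2 e`, the number `2 e j` is at most the square of `j x`.
      i = proj₁ (archimedean (x * x) (ι (e ℕ.* 2)) 0<x*x)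
      j = suc i
      instance
        _ = nonNegative (0≤fromℕ j)
        _ = nonNegative (<⇒≤ 0<x)
        _ = nonNegative (<⇒≤ 0<x*x)
      rearrange : ∀ a b → a * (a * (b * b)) ≡ a * b * (a * b)
      rearrange a b = trans (cong (a *_) (trans (sym (*-assoc a b b)) (*-comm (a * b) b))) (sym (*-assoc a b (a * b)))
      base : ι (e ℕ.* (2 ℕ.* j)) ≤ ρ ^ (2 ℕ.* j)
      base = begin
        ι (e ℕ.* (2 ℕ.* j))         ≡⟨ cong ι (trans (sym (ℕ.*-assoc e 2 j)) (ℕ.*-comm (e ℕ.* 2) j)) ⟩
        ι (j ℕ.* (e ℕ.* 2))         ≡⟨ ι-* j (e ℕ.* 2) ⟩
        ι j * ι (e ℕ.* 2)           ≤⟨ *-monoˡ-≤-nonNeg (ι j) (proj₂ (archimedean (x * x) (ι (e ℕ.* 2)) 0<x*x)) ⟩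
        ι j * (ι i * (x * x))       ≤⟨ *-monoˡ-≤-nonNeg (ι j) (*-monoʳ-≤-nonNeg (x * x) (ι-mono-≤ (ℕ.n≤1+n i))) ⟩
        ι j * (ι j * (x * x))       ≡⟨ rearrange (ι j) x ⟩
        ι j * x * (ι j * x)         ≤⟨ *-mono-≤-nonNeg (^-nonNeg j 0≤ρ) 0≤ιj*x (<⇒≤ (ι*[ρ-1]<ρ^ j)) (<⇒≤ (ι*[ρ-1]<ρ^ j)) ⟩
        ρ ^ j * ρ ^ j               ≡⟨ ^-homo-* ρ j j ⟨
        ρ ^ (j ℕ.+ j)               ≡⟨ cong (λ z → ρ ^ (j ℕ.+ z)) (ℕ.+-identityʳ j) ⟨
        ρ ^ (2 ℕ.* j)               ∎
        where
        0≤ιj*x : 0ℚ ≤ ι j * x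
        0≤ιj*x = nonNegative⁻¹ (ι j * x) {{nonNeg*nonNeg⇒nonNeg (ι j) x}}

  -- Of the two factors `ρ` that fit between `s` and `g`, one pays for the polynomial factor
  -- `ι N ^ e` and the other remains as a gain over `s`.
  absorb-factor : ∀ {s ρ g a} N e → 0ℚ < s → 0ℚ < ρ → s * ρ ^ 2 ≤ g → ι N ^ e ≤ ρ ^ N → 0ℚ ≤ a →
    g ^ N ≤ a * ι N ^ e → (s * ρ) ^ N ≤ a
  absorb-factor {s} {ρ} {g} {a} N e 0<s 0<ρ sρ²≤g N^e≤ρ^N 0≤a g^N≤ = *-cancelʳ-≤-pos (ρ ^ N) {{positive (^-pos N 0<ρ)}} (begin
    (s * ρ) ^ N * ρ ^ N     ≡⟨ ^-distrib-* (s * ρ) ρ N ⟨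
    (s * ρ * ρ) ^ N         ≡⟨ cong (_^ N) (trans (*-assoc s ρ ρ) (cong (λ x → s * (ρ * x)) (sym (*-identityʳ ρ)))) ⟩
    (s * ρ ^ 2) ^ N         ≤⟨ ^-mono-≤ N 0≤sρ² sρ²≤g ⟩
    g ^ N                   ≤⟨ g^N≤ ⟩
    a * ι N ^ e             ≤⟨ *-monoˡ-≤-nonNeg a {{nonNegative 0≤a}} N^e≤ρ^N ⟩
    a * ρ ^ N               ∎)
    where
    open ≤-Reasoning
    0≤sρ² = <⇒≤ (positive⁻¹ (s * ρ ^ 2) {{pos*pos⇒pos s {{positive 0<s}} (ρ ^ 2) {{positive (^-pos 2 0<ρ)}}}})

  -- From block counts to the growth of a sequence

  module _ (g : ℚ) (a A : ℕ → ℕ) (k e : ℕ) {{_ : NonZero k}} {{_ : NonZero e}}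
    (block-lower : ∀ B .{{_ : NonZero B}} → g ^ (k ℕ.* B) ≤ ι (A (k ℕ.* B)) * ι (k ℕ.* B) ^ (k ℕ.* e))
    (repeat-block : ∀ N t r → A N ℕ.^ t ℕ.≤ a ((t ℕ.+ k) ℕ.* N ℕ.+ r))
    where
    open ≤-Reasoning

    1≤a : ∀ n → 1ℚ ≤ ι (a n)
    -- Zero blocks of length zero, for which `A 0 ^ 0` is 1.
    1≤a n = ι-mono-≤ (subst (λ z → 1 ℕ.≤ a (z ℕ.+ n)) (ℕ.*-zeroʳ k) (repeat-block 0 0 n))

    module _ {s} (1≤s : 1ℚ ≤ s) (s<g : s < g) where
      private
        0<s = <-≤-trans (positive⁻¹ 1ℚ) 1≤s
        0≤s = <⇒≤ 0<s

      ρ-with-room : ∃[ ρ ] (1ℚ < ρ × s * ρ ^ 2 ≤ g)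
      ρ-with-room = split (enlarge 0≤s (subst (_< g) (sym (*-identityʳ s)) s<g))
        where
        split : ∃[ z ] (1ℚ < z × s * z < g) → ∃[ ρ ] (1ℚ < ρ × s * ρ ^ 2 ≤ g)
        split (z , 1<z , sz<g) = root-of-z (^-open-above 2 (nonNegative⁻¹ 1ℚ) (subst (_< z) (sym (1^n≡1 2)) 1<z))
          where
          root-of-z : ∃[ ρ ] (1ℚ < ρ × ρ ^ 2 < z) → ∃[ ρ ] (1ℚ < ρ × s * ρ ^ 2 ≤ g)
          root-of-z (ρ , 1<ρ , ρ²<z) = ρ , 1<ρ
            , <⇒≤ (≤-<-trans (*-monoˡ-≤-nonNeg s {{nonNegative 0≤s}} (<⇒≤ ρ²<z)) sz<g)

      large-block : ∀ {ρ} → 1ℚ < ρ → s * ρ ^ 2 ≤ g → ∃[ N ] (NonZero N × (s * ρ) ^ N ≤ ι (A N))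
      large-block {ρ} 1<ρ sρ²≤g = from (^-beats-power 1<ρ (k ℕ.* e))
        where
        from : ∃[ i ] (∀ N → N ≡ k ℕ.* e ℕ.* (2 ℕ.* suc i) → ι N ^ (k ℕ.* e) ≤ ρ ^ N) →
               ∃[ N ] (NonZero N × (s * ρ) ^ N ≤ ι (A N))
        from (i , N^e≤ρ^N) = N , ℕ.m*n≢0 k B
          , absorb-factor N (k ℕ.* e) 0<s (<-trans (positive⁻¹ 1ℚ) 1<ρ) sρ²≤g
              (N^e≤ρ^N N (sym (ℕ.*-assoc k e (2 ℕ.* suc i)))) (0≤fromℕ (A N)) (block-lower B)
          where
          -- This makes `N` a multiple of `k`, as `block-lower` needs, and at the same time the
          -- number for which `^-beats-power` with exponent `k * e` was proved.
          B = e ℕ.* (2 ℕ.* suc i)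
          N = k ℕ.* B
          instance
            B≢0 : NonZero B
            B≢0 = ℕ.m*n≢0 e (2 ℕ.* suc i)

      -- The `t` blocks exceed `s ^ (t * N)` by a factor `ρ ^ (t * N)`, at least `ρ ^ T`. This pays
      -- for the letters outside the blocks, at most `suc k * N` in number: `k * N` from the padding
      -- and a remainder `r`.
      repeated : ∀ {ρ N} T t r .{{_ : NonZero N}} → 1ℚ < ρ → (s * ρ) ^ N ≤ ι (A N) →
        s ^ (suc k ℕ.* N) < ρ ^ T → T ℕ.≤ t → r ℕ.≤ N →
        let n = (t ℕ.+ k) ℕ.* N ℕ.+ r in s ^ n < ι (a n)
      repeated {ρ} {N} T t r 1<ρ [sρ]^N≤A s^<ρ^T T≤t r≤N = begin-strict
        s ^ n                                     ≤⟨ ^-monoʳ-≤ 1≤s n≤ ⟩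
        s ^ (t ℕ.* N ℕ.+ suc k ℕ.* N)             ≡⟨ ^-homo-* s (t ℕ.* N) (suc k ℕ.* N) ⟩
        s ^ (t ℕ.* N) * s ^ (suc k ℕ.* N)         <⟨ *-monoʳ-<-pos (s ^ (t ℕ.* N)) {{positive (^-pos (t ℕ.* N) 0<s)}} s^<ρ^T ⟩
        s ^ (t ℕ.* N) * ρ ^ T                     ≤⟨ *-monoˡ-≤-nonNeg (s ^ (t ℕ.* N)) {{nonNegative (^-nonNeg (t ℕ.* N) 0≤s)}} (^-monoʳ-≤ (<⇒≤ 1<ρ) (ℕ.≤-trans T≤t (ℕ.m≤m*n t N))) ⟩
        s ^ (t ℕ.* N) * ρ ^ (t ℕ.* N)             ≡⟨ ^-distrib-* s ρ (t ℕ.* N) ⟨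
        (s * ρ) ^ (t ℕ.* N)                       ≡⟨ cong ((s * ρ) ^_) (ℕ.*-comm t N) ⟩
        (s * ρ) ^ (N ℕ.* t)                       ≡⟨ ^-assocʳ (s * ρ) N t ⟨
        ((s * ρ) ^ N) ^ t                         ≤⟨ ^-mono-≤ t (^-nonNeg N 0≤sρ) [sρ]^N≤A ⟩
        ι (A N) ^ t                               ≡⟨ ι-^ (A N) t ⟨
        ι (A N ℕ.^ t)                             ≤⟨ ι-mono-≤ (repeat-block N t r) ⟩
        ι (a n)                                   ∎
        where
        n = (t ℕ.+ k) ℕ.* N ℕ.+ r
        0≤sρ : 0ℚ ≤ s * ρ
        0≤sρ = <⇒≤ (positive⁻¹ (s * ρ) {{pos*pos⇒pos s {{positive 0<s}} ρ {{positive (<-trans (positive⁻¹ 1ℚ) 1<ρ)}}}})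
        n≤ : n ℕ.≤ t ℕ.* N ℕ.+ suc k ℕ.* N
        n≤ = ℕ.≤-trans (ℕ.+-monoʳ-≤ ((t ℕ.+ k) ℕ.* N) r≤N) (ℕ.≤-reflexive (arith t N k))
          where
          arith : ∀ t N k → (t ℕ.+ k) ℕ.* N ℕ.+ N ≡ t ℕ.* N ℕ.+ suc k ℕ.* N
          arith = solve-∀

      s^n<a-large : ∃[ N₀ ] (∀ n → N₀ ℕ.≤ n → s ^ n < ι (a n))
      s^n<a-large = from-ρ ρ-with-room
        where
        Goal = ∃[ N₀ ] (∀ n → N₀ ℕ.≤ n → s ^ n < ι (a n))
        from-ρ : ∃[ ρ ] (1ℚ < ρ × s * ρ ^ 2 ≤ g) → Goal
        from-ρ (ρ , 1<ρ , sρ²≤g) = from-N (large-block 1<ρ sρ²≤g)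
          where
          from-N : ∃[ N ] (NonZero N × (s * ρ) ^ N ≤ ι (A N)) → Goal
          from-N (N , N≢0 , [sρ]^N≤A) = from-T (^-unbounded 1<ρ (s ^ (suc k ℕ.* N)))
            where
            instance _ = N≢0
            from-T : ∃[ T ] s ^ (suc k ℕ.* N) < ρ ^ T → Goal
            -- Beyond this threshold `n / N` is at least `T + k`, so taking `k` away leaves at least
            -- `T` blocks, with `n % N` as the remainder.
            from-T (T , s^<ρ^T) = (T ℕ.+ k) ℕ.* N , bound
              where
              bound : ∀ n → (T ℕ.+ k) ℕ.* N ℕ.≤ n → s ^ n < ι (a n)
              bound n N₀≤n = subst (λ n → s ^ n < ι (a n)) n≡ (repeated T (q ℕ.∸ k) (n ℕ.% N) 1<ρ [sρ]^N≤A s^<ρ^T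
                (subst (ℕ._≤ q ℕ.∸ k) (ℕ.m+n∸n≡m T k) (ℕ.∸-monoˡ-≤ k T+k≤q)) (ℕ.<⇒≤ (ℕ.m%n<n n N)))
                where
                q = n ℕ./ N
                T+k≤q : T ℕ.+ k ℕ.≤ q
                T+k≤q = subst (ℕ._≤ q) (ℕ.m*n/n≡m (T ℕ.+ k) N) (ℕ./-monoˡ-≤ N N₀≤n)
                n≡ : (q ℕ.∸ k ℕ.+ k) ℕ.* N ℕ.+ n ℕ.% N ≡ n
                n≡ = trans (cong (λ z → z ℕ.* N ℕ.+ n ℕ.% N) (ℕ.m∸n+n≡m (ℕ.≤-trans (ℕ.m≤n+m k T) T+k≤q)))
                  (trans (ℕ.+-comm (q ℕ.* N) (n ℕ.% N)) (sym (ℕ.m≡m%n+[m/n]*n n N)))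

    -- The disjunction is membership of `s` in the lower cut of `root n (a n)`. Only `s` of at least
    -- 1 needs the block argument; for `s` in between, `1≤a` suffices.
    s^n<a : ∀ {s} → s < g → ∃[ N₀ ] (∀ n .{{_ : NonZero n}} → N₀ ℕ.≤ n → s < 0ℚ ⊎ s ^ n < ι (a n))
    s^n<a {s} s<g with s <? 0ℚ | s <? 1ℚ
    ... | yes s<0 | _       = 0 , λ _ _ → inj₁ s<0
    ... | no  s≮0 | yes s<1 = 0 , λ n _ → inj₂ (<-≤-trans (^-mono-< n (≮⇒≥ s≮0) s<1) (≤-trans (≤-reflexive (1^n≡1 n)) (1≤a n)))
    ... | no  _   | no  s≮1 = let N₀ , bound = s^n<a-large (≮⇒≥ s≮1) s<g in N₀ , λ n N₀≤n → inj₂ (bound n N₀≤n)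

  -- The growth rate of avoiding words

  module _ (k-1 : ℕ) where
    private
      k = suc k-1
      G = growthRate k
      K = k ℕ.^ suc k
      D = k-1 ℕ.^ k-1
      instance
        D≢0 : NonZero D
        D≢0 = m^m≢0 k-1
      0<ιD^ : ∀ n → Positive (ι D ^ n)
      0<ιD^ n = positive (^-pos n (ι-pos D))

    -- Clears the denominator of the growth rate, so that bounds by its powers reduce to
    -- inequalities between natural numbers.
    growthRate^n*D^n : ∀ n → G ^ n * ι D ^ n ≡ ι (k ℕ.^ (suc k ℕ.* n))
    growthRate^n*D^n n = begin
      G ^ n * ι D ^ n            ≡⟨ ^-distrib-* G (ι D) n ⟨
      (G * ι D) ^ n              ≡⟨ cong (_^ n) (/*ι K D) ⟩
      ι K ^ n                    ≡⟨ ι-^ K n ⟨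
      ι (K ℕ.^ n)                ≡⟨ cong ι (ℕ.^-*-assoc k (suc k) n) ⟩
      ι (k ℕ.^ (suc k ℕ.* n))    ∎
      where open ≡-Reasoning

    ιD^n : ∀ n → ι (k-1 ℕ.^ (k-1 ℕ.* n)) ≡ ι D ^ n
    ιD^n n = trans (cong ι (sym (ℕ.^-*-assoc k-1 k-1 n))) (ι-^ D n)

    open ≤-Reasoning

    w̄≤growthRate^n : ∀ n → ι (w̄ n k) ≤ G ^ n
    w̄≤growthRate^n n = *-cancelʳ-≤-pos (ι D ^ n) {{0<ιD^ n}} (begin
      ι (w̄ n k) * ι D ^ n                               ≡⟨ cong (ι (w̄ n k) *_) (ιD^n n) ⟨
      ι (w̄ n k) * ι (k-1 ℕ.^ (k-1 ℕ.* n))               ≡⟨ ι-* (w̄ n k) (k-1 ℕ.^ (k-1 ℕ.* n)) ⟨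
      ι (w̄ n k ℕ.* k-1 ℕ.^ (k-1 ℕ.* n))                 ≤⟨ ι-mono-≤ (ℕ.≤-trans (ℕ.*-monoˡ-≤ (k-1 ℕ.^ (k-1 ℕ.* n)) (w̄≤count n k)) (diagonal-upper k-1 n)) ⟩
      ι (k ℕ.^ (suc k ℕ.* n))                           ≡⟨ growthRate^n*D^n n ⟨
      G ^ n * ι D ^ n                                   ∎)

    growthRate^N≤diagonal*N^e : ∀ B .{{_ : NonZero B}} → let N = k ℕ.* B in
      G ^ N ≤ ι (diagonal k-1 N) * ι N ^ (k ℕ.* suc k)
    growthRate^N≤diagonal*N^e B = *-cancelʳ-≤-pos (ι D ^ N) {{0<ιD^ N}} (begin
      G ^ N * ι D ^ N                                    ≡⟨ growthRate^n*D^n N ⟩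
      ι (k ℕ.^ (suc k ℕ.* N))                            ≤⟨ ι-mono-≤ (diagonal-lower k-1 B) ⟩
      ι (A ℕ.* k-1 ℕ.^ (k-1 ℕ.* N) ℕ.* N ℕ.^ e)          ≡⟨ ι-* (A ℕ.* k-1 ℕ.^ (k-1 ℕ.* N)) (N ℕ.^ e) ⟩
      ι (A ℕ.* k-1 ℕ.^ (k-1 ℕ.* N)) * ι (N ℕ.^ e)        ≡⟨ cong₂ _*_ (trans (ι-* A (k-1 ℕ.^ (k-1 ℕ.* N))) (cong (ι A *_) (ιD^n N))) (ι-^ N e) ⟩
      ι A * ι D ^ N * ι N ^ e                            ≡⟨ swap (ι A) (ι D ^ N) (ι N ^ e) ⟩
      ι A * ι N ^ e * ι D ^ N                            ∎)
      where
      N = k ℕ.* B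
      A = diagonal k-1 N
      e = k ℕ.* suc k
      swap : ∀ a b c → a * b * c ≡ a * c * b
      swap a b c = trans (*-assoc a b c) (trans (cong (a *_) (*-comm b c)) (sym (*-assoc a c b)))

    root-w̄-converges : ConvergesTo (λ n → root n (w̄ n k)) (fromℚ G)
    root-w̄-converges ε 0<ε =
      -- One rational `q` strictly between `G` and `G + ε` witnesses both inequalities: it lies
      -- above the root by the upper bound, and `q - ε < G` lies eventually below the root by the
      -- lower bound.
      let q , G<q , q<G+ε = <-dense (subst (_< G + ε) (+-identityʳ G) (+-monoʳ-< G 0<ε))
          q-ε<G           = subst (q - ε <_) (cancel⁻ G ε) (+-monoˡ-< (- ε) q<G+ε)
          N₀ , bound      = s^n<a G (λ n → w̄ n k) (diagonal k-1) k (suc k) growthRate^N≤diagonal*N^e (diagonal^t≤w̄ k-1) q-ε<G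
      in N₀ , λ n N₀≤n → (q , (≤-<-trans 0≤G G<q , ≤-<-trans (w̄≤growthRate^n n) (^-mono-< n 0≤G G<q)) , q-ε<G)
                       , (q , G<q , bound n N₀≤n)
      where
      0≤G : 0ℚ ≤ G
      0≤G = nonNegative⁻¹ G {{normalize-nonNeg K D}}

  ConvergesTo⇒IsLimSup : ∀ x ℓ → ConvergesTo x ℓ → IsLimSup x ℓ
  ConvergesTo⇒IsLimSup x ℓ x⟶ℓ ε 0<ε = let N₀ , bound = x⟶ℓ ε 0<ε in
    (N₀ , λ n N₀≤n → proj₁ (bound n N₀≤n)) ,
    -- An index beyond both thresholds; the successor makes it nonzero.
    λ N → suc (N ℕ.+ N₀) , _ , ℕ.m≤n⇒m≤1+n (ℕ.m≤m+n N N₀)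
        , proj₂ (bound (suc (N ℕ.+ N₀)) (ℕ.m≤n⇒m≤1+n (ℕ.m≤n+m N₀ N)))

theorem3p9 : (k : ℕ) .{{_ : NonZero k}} →
    (∀ n (w : Word n n) →
    (¬ HasWeaklyIncreasingSubsequence (suc k) w) ⇔ Avoids (std w) (identity (suc k))) ×
    (∃[ ℓ ] ConvergesTo (λ n → root n (w̄ n k)) ℓ) ×
    IsLimSup (λ n → root n (w̄ n k)) (fromℚ (growthRate k))
theorem3p9 k@(suc k-1) =
  (λ n w → avoids⇔std-avoids w (suc k)) ,
  (fromℚ (growthRate k) , root-w̄-converges k-1) ,
  ConvergesTo⇒IsLimSup (λ n → root n (w̄ n k)) (fromℚ (growthRate k)) (root-w̄-converges k-1)
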